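{- Let $b$ be the number of bits in a computer word, and assume that bitwise operations on bit vectors of length $b$ take $O(1)$ time. Let $G=(V,E)$ be a finite undirected, unweighted graph with $m$ edges, let $r\in V$, and let $S_r\subseteq N_G(r)$ with $|S_r|\le b$. (1) There is an algorithm that, given $G$, $r$ and $S_r$, computes in $O(m)$ time the values $d_G(r,v)$, $S_r^{ -1}(v)$ and $S_r^{0}(v)$ for all $v\in V$ that are reachable from $\{r\}\cup S_r$ (that is, it performs breadth-first searches from the up to $b+1$ roots $\{r\}\cup S_r$ simultaneously). (2) For any vertices $s,t\in V$ reachable from $r$, given $d_G(r,s),S_r^{ -1}(s),S_r^{0}(s)$ and $d_G(r,t),S_r^{ -1}(t),S_r^{0}(t)$, the distance between $s$ and $t$ via one of the vertices of $\{r\}\cup S_r$, namely $$\delta=\min_{u\in\{r\}\cup S_r}\bigl(d_G(s,u)+d_G(u,t)\bigr),$$ can be computed in $O(1)$ time.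
   Context: $d_G(u,v)$ is the shortest-path distance (number of edges) between $u$ and $v$ in $G$, with $d_G(u,v)=\infty$ if $u$ and $v$ are disconnected; $N_G(r)$ is the set of neighbors of $r$. For $i\in\{ -1,0,+1\}$ and $v\in V$ reachable from $r$, $$S_r^{i}(v)=\{u\in S_r\mid d_G(u,v)-d_G(r,v)=i\}.$$ Subsets of $S_r$ are represented by bit vectors of $b$ bits: each vertex of $S_r$ is assigned a unique number between $1$ and $|S_r|$, and the presence of the $i$-th vertex is expressed by setting the $i$-th bit. The graph is given by adjacency lists. -}

module Defs where

open import Level using (0ℓ)
open import Data.Bool.Base using (Bool; true; false; not; if_then_else_)
open import Data.Nat.Base using (ℕ; zero; suc; _+_; _∸_; _≤_; _≡ᵇ_; _<ᵇ_)
open import Data.Integer.Base as ℤ using (ℤ; +_)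
open import Data.Fin.Base using (Fin; toℕ)
open import Data.Fin.Properties using (_<?_)
open import Data.Fin.Subset using (Subset; _∈_; ∣_∣; ⊥; ∁; _∩_; _∪_)
open import Data.Fin.Subset.Properties using (nonempty?)
open import Data.List.Base using (List; []; _∷_; length; map; filter; allFin; cartesianProduct)
import Data.List.Membership.Propositional as List
open import Data.List.Relation.Unary.Unique.Propositional using (Unique)
open import Data.Product.Base using (_×_; _,_; ∃; ∃₂; ∃-syntax)
open import Data.Vec.Base using (tabulate)
open import Function.Bundles using (_⇔_)
open import Function.Definitions using (Injective)
open import Relation.Binary.Core using (Rel)
open import Relation.Binary.Definitions using (Decidable; Symmetric; Irreflexive)
open import Relation.Binary.PropositionalEquality using (_≡_)
open import Relation.Nullary.Decidable using (does; _×-dec_)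
open import Relation.Unary using (Pred)

------------------------------------------------------------------------
-- Graphs and distances

-- Finite simple undirected graphs on the vertex set Fin n.
record Graph : Set₁ where
  infix 4 _~_ _~?_
  field
    n      : ℕ
    _~_    : Rel (Fin n) 0ℓ
    _~?_   : Decidable _~_
    sym    : Symmetric _~_
    irrefl : Irreflexive _≡_ _~_

  V : Set
  V = Fin n

  -- Each edge {u , v} is listed once, as the pair with u < v.
  edges : List (V × V)
  edges = filter (λ (u , v) → (u <? v) ×-dec (u ~? v))
                 (cartesianProduct (allFin n) (allFin n))

  m : ℕ
  m = length edges

IsMinimum : Pred ℕ 0ℓ → ℕ → Set
IsMinimum P k = P k × (∀ j → P j → k ≤ j)

module _ (G : Graph) where
  open Graph G

  data Walk : V → V → ℕ → Set where
    nil  : ∀ {u} → Walk u u 0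
    cons : ∀ {u v w k} → u ~ v → Walk v w k → Walk u w (suc k)

  Reachable : V → V → Set
  Reachable u v = ∃ (Walk u v)

  -- "d(u , v) is finite and equal to k"; d(u , v) = ∞ is ¬ Reachable u v.
  IsDist : V → V → ℕ → Set
  IsDist u v = IsMinimum (Walk u v)

  record AdjacencyLists : Set where
    field
      nbrs     : V → List V
      distinct : ∀ u → Unique (nbrs u)
      complete : ∀ u v → (v List.∈ nbrs u) ⇔ (u ~ v)

  -- A set S ⊆ N(r) with at most b elements, together with the numbering of
  -- its elements that fixes their bit positions (counted from 0).
  record RootSet (r : V) (b : ℕ) : Set where
    field
      S             : Subset n
      S⊆N           : ∀ u → u ∈ S → r ~ u
      small         : ∣ S ∣ ≤ b
      nth           : Fin ∣ S ∣ → V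
      nth-injective : Injective _≡_ _≡_ nth
      nth-image     : ∀ u → u ∈ S ⇔ (∃[ i ] nth i ≡ u)

  module _ {r : V} {b : ℕ} (R : RootSet r b) where
    open RootSet R

    S^ : ℤ → V → Pred V 0ℓ
    S^ i v u = u ∈ S ×
      ∃₂ λ x y → IsDist u v x × IsDist r v y × (+ x) ℤ.- (+ y) ≡ i

    -- The word w represents the subset P of S; bits at positions ≥ ∣ S ∣ are 0.
    Represents : Subset b → Pred V 0ℓ → Set
    Represents w P = ∀ (j : Fin b) →
      j ∈ w ⇔ (∃[ i ] toℕ i ≡ toℕ j × P (nth i))

------------------------------------------------------------------------
-- The machine: a unit-cost RAM with two kinds of cells, holding natural
-- numbers and words of b bits respectively.  For either kind there are
-- registers and arrays, both named by numerals in the program text.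
-- Programs do not mention b.  Vertices and distances are numbers, sets of
-- roots are words; the only passage from numbers to words is 1 << i.

data Sort : Set where
  nat word : Sort

⟦_⟧ : Sort → ℕ → Set
⟦ nat  ⟧ b = ℕ
⟦ word ⟧ b = Subset b

infixl 6 _⊕_ _⊝_ _or_
infixl 7 _and_
infix  8 _[_]

data Exp : Sort → Set where
  reg     : ∀ {s} → ℕ → Exp s
  _[_]    : ∀ {s} → ℕ → Exp nat → Exp s
  lit     : ℕ → Exp nat
  _⊕_ _⊝_ : Exp nat → Exp nat → Exp nat
  zeros   : Exp word
  bit     : Exp nat → Exp word
  compl   : Exp word → Exp word
  _and_   : Exp word → Exp word → Exp word
  _or_    : Exp word → Exp word → Exp word

data Test : Set where
  _≐_ _≺_ : Exp nat → Exp nat → Test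
  nonzero : Exp word → Test

infix  3 _≔_ _[_]≔_
infixr 2 _⨾_

data Cmd : Set where
  skip     : Cmd
  _≔_      : ∀ {s} → ℕ → Exp s → Cmd
  _[_]≔_   : ∀ {s} → ℕ → Exp nat → Exp s → Cmd
  _⨾_      : Cmd → Cmd → Cmd
  if_∶_∶_  : Test → Cmd → Cmd → Cmd
  while_∶_ : Test → Cmd → Cmd

record State (b : ℕ) : Set where
  field
    regs   : ∀ s → ℕ → ⟦ s ⟧ b
    arrays : ∀ s → ℕ → ℕ → ⟦ s ⟧ b
open State public

_[_↦_] : {A : Set} → (ℕ → A) → ℕ → A → (ℕ → A)
(f [ x ↦ a ]) y = if x ≡ᵇ y then a else f y

updateSort : {F : Sort → Set} → (∀ s → F s) → (s : Sort) → F s → (∀ s → F s)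
updateSort f nat  a nat  = a
updateSort f nat  a word = f word
updateSort f word a nat  = f nat
updateSort f word a word = a

module _ {b : ℕ} where

  setReg : State b → (s : Sort) → ℕ → ⟦ s ⟧ b → State b
  setReg σ s x a = record σ
    { regs = updateSort {λ s → ℕ → ⟦ s ⟧ b} (regs σ) s (regs σ s [ x ↦ a ]) }

  setArray : State b → (s : Sort) → ℕ → ℕ → ⟦ s ⟧ b → State b
  setArray σ s x i a = record σ
    { arrays = updateSort {λ s → ℕ → ℕ → ⟦ s ⟧ b} (arrays σ) s
                 (arrays σ s [ x ↦ arrays σ s x [ i ↦ a ] ]) }

  eval : ∀ {s} → Exp s → State b → ⟦ s ⟧ b
  eval {s} (reg x)   σ = regs σ s x
  eval {s} (x [ e ]) σ = arrays σ s x (eval e σ)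
  eval (lit k)       σ = k
  eval (e ⊕ f)       σ = eval e σ + eval f σ
  eval (e ⊝ f)       σ = eval e σ ∸ eval f σ
  eval zeros         σ = ⊥
  -- The word 1 << i, which is 0 on overflow (i ≥ b).
  eval (bit e)       σ = tabulate λ j → toℕ j ≡ᵇ eval e σ
  eval (compl e)     σ = ∁ (eval e σ)
  eval (e and f)     σ = eval e σ ∩ eval f σ
  eval (e or f)      σ = eval e σ ∪ eval f σ

  test : Test → State b → Bool
  test (e ≐ f)     σ = eval e σ ≡ᵇ eval f σ
  test (e ≺ f)     σ = eval e σ <ᵇ eval f σ
  test (nonzero e) σ = does (nonempty? (eval e σ))

-- Every operation, on numbers or on words, costs one time unit.
cost : ∀ {s} → Exp s → ℕ
cost (reg x)   = 1
cost (x [ e ]) = suc (cost e)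
cost (lit k)   = 1
cost (e ⊕ f)   = suc (cost e + cost f)
cost (e ⊝ f)   = suc (cost e + cost f)
cost zeros     = 1
cost (bit e)   = suc (cost e)
cost (compl e) = suc (cost e)
cost (e and f) = suc (cost e + cost f)
cost (e or f)  = suc (cost e + cost f)

costTest : Test → ℕ
costTest (e ≐ f)     = suc (cost e + cost f)
costTest (e ≺ f)     = suc (cost e + cost f)
costTest (nonzero e) = suc (cost e)

-- ⟨ p , σ ⟩⇓⟨ σ′ , t ⟩: p started in σ halts in σ′ after t time units.
infix 4 ⟨_,_⟩⇓⟨_,_⟩

data ⟨_,_⟩⇓⟨_,_⟩ {b : ℕ} : Cmd → State b → State b → ℕ → Set where
  ⇓skip : ∀ {σ} → ⟨ skip , σ ⟩⇓⟨ σ , 1 ⟩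
  ⇓≔ : ∀ {σ s x} {e : Exp s} →
    ⟨ x ≔ e , σ ⟩⇓⟨ setReg σ s x (eval e σ) , suc (cost e) ⟩
  ⇓[]≔ : ∀ {σ s x i} {e : Exp s} →
    ⟨ x [ i ]≔ e , σ ⟩⇓⟨ setArray σ s x (eval i σ) (eval e σ) , suc (cost i + cost e) ⟩
  ⇓⨾ : ∀ {σ₁ σ₂ σ₃ p q t u} →
    ⟨ p , σ₁ ⟩⇓⟨ σ₂ , t ⟩ → ⟨ q , σ₂ ⟩⇓⟨ σ₃ , u ⟩ →
    ⟨ p ⨾ q , σ₁ ⟩⇓⟨ σ₃ , t + u ⟩
  ⇓if-true : ∀ {σ σ′ c p q t} → test c σ ≡ true →
    ⟨ p , σ ⟩⇓⟨ σ′ , t ⟩ → ⟨ if c ∶ p ∶ q , σ ⟩⇓⟨ σ′ , suc (costTest c + t) ⟩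
  ⇓if-false : ∀ {σ σ′ c p q t} → test c σ ≡ false →
    ⟨ q , σ ⟩⇓⟨ σ′ , t ⟩ → ⟨ if c ∶ p ∶ q , σ ⟩⇓⟨ σ′ , suc (costTest c + t) ⟩
  ⇓while-false : ∀ {σ c p} → test c σ ≡ false →
    ⟨ while c ∶ p , σ ⟩⇓⟨ σ , suc (costTest c) ⟩
  ⇓while-true : ∀ {σ₁ σ₂ σ₃ c p t u} → test c σ₁ ≡ true →
    ⟨ p , σ₁ ⟩⇓⟨ σ₂ , t ⟩ → ⟨ while c ∶ p , σ₂ ⟩⇓⟨ σ₃ , u ⟩ →
    ⟨ while c ∶ p , σ₁ ⟩⇓⟨ σ₃ , suc (costTest c + t + u) ⟩

------------------------------------------------------------------------
-- Input and output conventions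

-- A singly linked list in memory: a list is given by the address of its
-- first cell, and address 0 is the null pointer.
data LinkedList (value next : ℕ → ℕ) : ℕ → List ℕ → Set where
  null : LinkedList value next 0 []
  cell : ∀ {p x xs} → value (suc p) ≡ x → LinkedList value next (next (suc p)) xs →
         LinkedList value next (suc p) (x ∷ xs)

-- Memory that holds no input is initially zero: here registers x ≥ k and
-- arrays x ≥ l.
FreshNat : ∀ {b} → ℕ → ℕ → State b → Set
FreshNat k l σ = (∀ x → k ≤ x → regs σ nat x ≡ 0)
               × (∀ x → l ≤ x → ∀ i → arrays σ nat x i ≡ 0)

FreshWord : ∀ {b} → ℕ → ℕ → State b → Set
FreshWord k l σ = (∀ x → k ≤ x → regs σ word x ≡ ⊥)
                × (∀ x → l ≤ x → ∀ i → arrays σ word x i ≡ ⊥)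

module _ (G : Graph) where
  open Graph G

  -- Number registers 0, 1, 2: the number of vertices, r and ∣ S ∣.
  -- Number arrays 0, 1, 2: heads of the adjacency lists, and the values and
  -- next-pointers of their cells.  Number array 3: the elements of S.
  record BFSInput (A : AdjacencyLists G) (r : V) {b} (R : RootSet G r b)
                  (σ : State b) : Set where
    open AdjacencyLists A
    open RootSet R
    field
      reg-n     : regs σ nat 0 ≡ n
      reg-r     : regs σ nat 1 ≡ toℕ r
      reg-∣S∣   : regs σ nat 2 ≡ ∣ S ∣
      adjacency : ∀ v → LinkedList (arrays σ nat 1) (arrays σ nat 2)
                          (arrays σ nat 0 (toℕ v)) (map toℕ (nbrs v))
      roots     : ∀ i → arrays σ nat 3 (toℕ i) ≡ toℕ (nth i)
      freshNat  : FreshNat 3 4 σ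
      freshWord : FreshWord 0 0 σ

  -- Number array 4 holds d(r , v), word arrays 0 and 1 hold S⁻¹(v) and S⁰(v).
  record BFSOutput (r : V) {b} (R : RootSet G r b) (σ : State b) (v : V) : Set where
    field
      dist : IsDist G r v (arrays σ nat 4 (toℕ v))
      S⁻¹  : Represents G R (arrays σ word 0 (toℕ v)) (S^ G R (ℤ.- (+ 1)) v)
      S⁰   : Represents G R (arrays σ word 1 (toℕ v)) (S^ G R (+ 0) v)

  -- Number registers 0, 1: d(r , s), d(r , t).
  -- Word registers 0, 1, 2, 3: S⁻¹(s), S⁰(s), S⁻¹(t), S⁰(t).
  record QueryInput (r : V) {b} (R : RootSet G r b) (s t : V) (σ : State b) : Set where
    field
      dist-s    : IsDist G r s (regs σ nat 0)
      dist-t    : IsDist G r t (regs σ nat 1)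
      S⁻¹-s     : Represents G R (regs σ word 0) (S^ G R (ℤ.- (+ 1)) s)
      S⁰-s      : Represents G R (regs σ word 1) (S^ G R (+ 0) s)
      S⁻¹-t     : Represents G R (regs σ word 2) (S^ G R (ℤ.- (+ 1)) t)
      S⁰-t      : Represents G R (regs σ word 3) (S^ G R (+ 0) t)
      freshNat  : FreshNat 2 0 σ
      freshWord : FreshWord 4 0 σ

{-# OPTIONS --safe #-}
module Submission where

-- Let S⁻¹(v) and S⁰(v) be the sets of roots that are one step nearer to v than
-- r is, respectively equally near.  Since every root is adjacent to r, a root u
-- lies in S⁻¹(v) iff there is a walk of length d(r , v) - 1 from u to v.  Looking
-- at the last edge of such a walk, S⁻¹(v) consists of v itself, if it is a root,
-- and the S⁻¹(u) for the neighbours u of v that are nearer to r; likewise S⁰(v)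
-- consists of the S⁻¹(u) for the neighbours u at the same distance from r and the
-- S⁰(u) for those that are nearer, without S⁻¹(v).  So after an ordinary search
-- from r, two sweeps over its queue, in which every vertex collects words from
-- its neighbours, suffice; the time is proportional to the number of vertices
-- reached plus the sum of their degrees, that is O(m + 1).
--
-- For the query, d(s , r) + d(r , t) is lowered by 2 iff S⁻¹(s) meets S⁻¹(t), and
-- otherwise by 1 iff one of S⁻¹(s), S⁻¹(t) meets the S⁰ of the other vertex.

open import Defs
open import Data.Bool.Base using (true; false)
open import Data.Fin.Base using (Fin; zero; suc; toℕ; fromℕ<; inject≤)
open import Data.Fin.Properties
  using (toℕ-injective; toℕ-fromℕ<; toℕ-inject≤; toℕ<n; injective⇒≤; <-cmp) renaming (_≟_ to _≟F_)
open import Data.Fin.Subset using (Subset; Nonempty; _∈_; _∪_; _∩_; ∁; ∣_∣; ⁅_⁆)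
open import Data.Fin.Subset.Properties
  using (nonempty?; ∉⊥; x∈⁅x⁆; x∈⁅y⁆⇒x≡y; x∈p∩q⁺; x∈p∩q⁻; x∈p∪q⁺; x∈p∪q⁻; x∈∁p⇒x∉p; x∉p⇒x∈∁p)
open import Data.Integer.Base as ℤ using (_⊖_)
import Data.Integer.Properties as ℤ
open import Data.List.Base using (List; []; _∷_; length; map; lookup; _++_; _∷ʳ_; concatMap)
import Data.List.Membership.Propositional as List
open import Data.List.Membership.Propositional.Properties
  using (∈-lookup; ∈-map⁺; ∈-map⁻; ∈-filter⁺; ∈-cartesianProduct⁺; ∈-allFin; ∈-++⁺ˡ; ∈-++⁺ʳ; ∈-++⁻)
open import Data.List.Properties
  using (length-++; length-map; length-tabulate; map-++; map-∘; ++-assoc; ++-identityʳ; ∷ʳ-++)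
open import Data.List.Relation.Unary.All as All using (All; []; _∷_)
import Data.List.Relation.Unary.All.Properties as All
open import Data.List.Relation.Unary.AllPairs using (AllPairs; []; _∷_)
import Data.List.Relation.Unary.AllPairs.Properties as AllPairs
open import Data.List.Relation.Unary.Any as Any using (Any; here; there)
open import Data.List.Relation.Unary.Any.Properties using (lookup-index)
open import Data.List.Relation.Unary.Unique.Propositional using (Unique)
import Data.List.Relation.Unary.Unique.Propositional.Properties as Unique
open import Data.Nat.Base
  using (ℕ; zero; suc; _+_; _*_; _∸_; _≤_; _<_; _≡ᵇ_; _<ᵇ_; z≤n; s≤s; s≤s⁻¹)
open import Data.Nat.ListAction using (sum)
open import Data.Nat.ListAction.Properties using (sum-++)
open import Data.Nat.Properties hiding (<-cmp)
open import Data.Nat.Tactic.RingSolver using (solve-∀)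
open import Data.Product.Base using (_×_; _,_; ∃; ∃₂; ∃-syntax; proj₁; proj₂; swap)
open import Data.Sum.Base using (_⊎_; inj₁; inj₂)
open import Data.Unit.Base using (⊤; tt)
open import Data.Vec.Base using (tabulate)
open import Data.Vec.Properties using ([]=⇒lookup; lookup⇒[]=; lookup∘tabulate)
open import Function.Base using (_∘_)
open import Function.Bundles using (_⇔_; mk⇔; Equivalence)
open import Level using (Level; 0ℓ)
open import Relation.Binary.Core using (Rel)
open import Relation.Binary.Definitions using (tri<; tri≈; tri>)
open import Relation.Binary.PropositionalEquality
  using (_≡_; _≢_; refl; sym; trans; cong; cong₂; subst)
open import Relation.Nullary using (¬_; contradiction; yes; no)
open import Relation.Nullary.Decidable using (does)
open import Relation.Unary using (Pred)

open Equivalence using (to; from)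

-- Lists without repetitions

-- Collecting for S⁰(v) only finds roots with a walk of length d(r , v) to v. Such a walk does not
-- exclude a shorter one, which may pass through another neighbour of v; hence the subtraction of
-- S⁻¹(v). A neighbour on the same level as v may come later in the queue, so S⁻¹ must be finished
-- everywhere before S⁰ is begun: this forces two sweeps instead of one.
--
-- The time bound must not contain the number n of vertices. The zero-filled memory replaces an
-- initialising loop, and unreached vertices are never touched. Every reached vertex other than r
-- has positive degree, so the number of reached vertices is at most one more than the sum of their
-- degrees, which is at most 2m.
--
-- Each loop invariant carries lists of vertices with their levels that mirror the queue. The search
-- extends the queue while reading it, so neither termination nor the final time can be read off the
-- starting queue.

module _ {a : Level} {A : Set a} where

  lookup-injective : {xs : List A} → Unique xs →
                     ∀ {i j} → lookup xs i ≡ lookup xs j → i ≡ j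
  lookup-injective {_ ∷ _}  _        {zero}  {zero}  _  = refl
  lookup-injective {_ ∷ xs} (x∉ ∷ _) {zero}  {suc j} eq =
    contradiction eq (All.lookup x∉ (∈-lookup j))
  lookup-injective {_ ∷ xs} (x∉ ∷ _) {suc i} {zero}  eq =
    contradiction (sym eq) (All.lookup x∉ (∈-lookup i))
  lookup-injective {_ ∷ _}  (_ ∷ u)  {suc i} {suc j} eq = cong suc (lookup-injective u eq)

  -- Pigeonhole: sending a position in `xs` to one in `ys` with the same entry is injective, because
  -- `xs` repeats nothing; `ys` may.
  unique-⊆⇒length≤ : {xs ys : List A} → Unique xs →
                     (∀ {x} → x List.∈ xs → x List.∈ ys) → length xs ≤ length ys
  unique-⊆⇒length≤ {xs} {ys} unique xs⊆ys = injective⇒≤ position-injective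
    where
    position : Fin (length xs) → Fin (length ys)
    position i = Any.index (xs⊆ys (∈-lookup i))

    position-injective : ∀ {i j} → position i ≡ position j → i ≡ j
    position-injective {i} {j} eq = lookup-injective unique
      (trans (lookup-index (xs⊆ys (∈-lookup i)))
        (trans (cong (lookup ys) eq) (sym (lookup-index (xs⊆ys (∈-lookup j))))))

length-unique-Fin : ∀ {n} {xs : List (Fin n)} → Unique xs → length xs ≤ n
length-unique-Fin unique = injective⇒≤ (lookup-injective unique)

-- Walks and distances

IsMinimum-unique : ∀ {P j k} → IsMinimum P j → IsMinimum P k → j ≡ k
IsMinimum-unique (pj , minj) (pk , mink) = ≤-antisym (minj _ pk) (mink _ pj)

module _ {G : Graph} where
  open Graph G using (V; m; _~_; edges; irrefl) renaming (sym to ~-sym)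

  snoc : ∀ {u v w k} → Walk G u v k → v ~ w → Walk G u w (suc k)
  snoc nil        e = cons e nil
  snoc (cons d p) e = cons d (snoc p e)

  unsnoc : ∀ {u w k} → Walk G u w (suc k) → ∃[ v ] (Walk G u v k × v ~ w)
  unsnoc (cons e nil)          = _ , nil , e
  unsnoc (cons e p@(cons _ _)) = let v , q , d = unsnoc p in v , cons e q , d

  reverse : ∀ {u v k} → Walk G u v k → Walk G v u k
  reverse nil        = nil
  reverse (cons e p) = snoc (reverse p) (~-sym e)

  IsDist-sym : ∀ {u v k} → IsDist G u v k → IsDist G v u k
  IsDist-sym (p , min) = reverse p , λ j q → min j (reverse q)

  -- `edges` holds each edge in its increasing orientation only, so every arc lies in `edges` or in
  -- its swapped copy.
  length-arcs≤2m : {as : List (V × V)} → Unique as →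
                   All (λ (u , v) → u ~ v) as → length as ≤ m + m
  length-arcs≤2m {as} unique adjacent = begin
    length as                      ≤⟨ unique-⊆⇒length≤ unique as⊆ ⟩
    length (edges ++ map swap edges) ≡⟨ length-++ edges ⟩
    m + length (map swap edges)    ≡⟨ cong (m +_) (length-map swap edges) ⟩
    m + m                          ∎
    where
    open ≤-Reasoning
    as⊆ : ∀ {a} → a List.∈ as → a List.∈ edges ++ map swap edges
    as⊆ {u , v} a∈ with <-cmp u v
    ... | tri< u<v _ _ = ∈-++⁺ˡ
      (∈-filter⁺ _ (∈-cartesianProduct⁺ (∈-allFin u) (∈-allFin v))
                   (u<v , All.lookup adjacent a∈))
    ... | tri≈ _ u≡v _ = contradiction (All.lookup adjacent a∈) (irrefl u≡v)
    ... | tri> _ _ v<u = ∈-++⁺ʳ edges (∈-map⁺ swap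
      (∈-filter⁺ _ (∈-cartesianProduct⁺ (∈-allFin v) (∈-allFin u))
                   (v<u , ~-sym (All.lookup adjacent a∈))))

  module _ (A : AdjacencyLists G) where
    open AdjacencyLists A

    degree : V → ℕ
    degree v = length (nbrs v)

    arcs : List V → List (V × V)
    arcs = concatMap (λ u → map (u ,_) (nbrs u))

    length-arcs : ∀ us → length (arcs us) ≡ sum (map degree us)
    length-arcs []       = refl
    length-arcs (u ∷ us) = trans (length-++ (map (u ,_) (nbrs u)))
      (trans (cong (_+ _) (length-map (u ,_) (nbrs u))) (cong (degree u +_) (length-arcs us)))

    -- The degrees count the arcs leaving `us`. No arc is counted twice: tails differ between
    -- vertices, heads differ within one adjacency list.
    sum-degree≤2m : ∀ {us} → Unique us → sum (map degree us) ≤ m + m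
    sum-degree≤2m {us} unique = ≤-trans (≤-reflexive (sym (length-arcs us)))
      (length-arcs≤2m (arcs-unique unique) (arcs-adjacent us))
      where
      arcs-adjacent : ∀ us → All (λ (u , v) → u ~ v) (arcs us)
      arcs-adjacent []       = []
      arcs-adjacent (u ∷ us) = All.++⁺
        (All.map⁺ (All.tabulate (λ {v} → to (complete u v)))) (arcs-adjacent us)

      tails : ∀ {u us} → All (u ≢_) us → All (λ a → u ≢ proj₁ a) (arcs us)
      tails []        = []
      tails {us = w ∷ _} (u≢w ∷ u∉) = All.++⁺
        (All.map⁺ (All.universal (λ _ → u≢w) (nbrs w))) (tails u∉)

      arcs-unique : ∀ {us} → Unique us → Unique (arcs us)
      arcs-unique []       = []
      arcs-unique {u ∷ us} (u∉ ∷ us!) = Unique.++⁺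
        (Unique.map⁺ (cong proj₂) (distinct u)) (arcs-unique us!)
        (λ (a∈₁ , a∈₂) → let _ , _ , a≡ = ∈-map⁻ (u ,_) a∈₁ in
          All.lookup (tails u∉) a∈₂ (sym (cong proj₁ a≡)))

-- S⁻¹ and S⁰ in terms of walks, and their recurrences

m-[1+m]≡-1 : ∀ k → (ℤ.+ k) ℤ.- (ℤ.+ suc k) ≡ ℤ.- (ℤ.+ 1)
m-[1+m]≡-1 k = trans (ℤ.[+m]-[+n]≡m⊖n k (suc k)) (k⊖[1+k] k)
  where
  k⊖[1+k] : ∀ k → k ⊖ suc k ≡ ℤ.- (ℤ.+ 1)
  k⊖[1+k] zero    = refl
  k⊖[1+k] (suc k) = trans (ℤ.[1+m]⊖[1+n]≡m⊖n k (suc k)) (k⊖[1+k] k)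

m-n≡-1⇒1+m≡n : ∀ m n → (ℤ.+ m) ℤ.- (ℤ.+ n) ≡ ℤ.- (ℤ.+ 1) → suc m ≡ n
m-n≡-1⇒1+m≡n m n eq = difference m n (trans (sym (ℤ.[+m]-[+n]≡m⊖n m n)) eq)
  where
  difference : ∀ m n → m ⊖ n ≡ ℤ.- (ℤ.+ 1) → suc m ≡ n
  difference zero    (suc zero) _  = refl
  difference (suc m) (suc n)    eq =
    cong suc (difference m n (trans (sym (ℤ.[1+m]⊖[1+n]≡m⊖n m n)) eq))

module _ {G : Graph} {r : Graph.V G} {b : ℕ} (R : RootSet G r b) where
  open Graph G using (V; _~_; irrefl) renaming (sym to ~-sym)
  open RootSet R

  -- No distance from x is mentioned: d(r , v) ≤ d(x , v) + 1 already bounds walks from below. The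
  -- negation in `Level₀` corresponds to the masking by a complement in the program.
  Near Level₀ : V → V → Set
  Near v x = x ∈ S × ∃[ k ] (Walk G x v k × IsDist G r v (suc k))
  Level₀ v x = x ∈ S × ¬ Near v x × ∃[ k ] (Walk G x v k × IsDist G r v k)

  S⁻¹⇔Near : ∀ {v x} → S^ G R (ℤ.- (ℤ.+ 1)) v x ⇔ Near v x
  S⁻¹⇔Near {v} {x} = mk⇔ ⇒ ⇐
    where
    ⇒ : S^ G R (ℤ.- (ℤ.+ 1)) v x → Near v x
    ⇒ (x∈S , k , ℓ , (p , _) , dv , eq) with refl ← m-n≡-1⇒1+m≡n k ℓ eq = x∈S , k , p , dv

    ⇐ : Near v x → S^ G R (ℤ.- (ℤ.+ 1)) v x
    ⇐ (x∈S , k , p , dv) = x∈S , k , suc k ,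
      (p , λ j q → s≤s⁻¹ (proj₂ dv _ (cons (S⊆N x x∈S) q))) , dv , m-[1+m]≡-1 k

  S⁰⇔Level₀ : ∀ {v x} → S^ G R (ℤ.+ 0) v x ⇔ Level₀ v x
  S⁰⇔Level₀ {v} {x} = mk⇔ ⇒ ⇐
    where
    ⇒ : S^ G R (ℤ.+ 0) v x → Level₀ v x
    ⇒ (x∈S , k , ℓ , (p , min) , dv , eq) with refl ← ℤ.+-injective (ℤ.i-j≡0⇒i≡j (ℤ.+ k) (ℤ.+ ℓ) eq) =
      x∈S , (λ (_ , j , q , dv′) → 1+n≰n (≤-trans (≤-reflexive (IsMinimum-unique dv′ dv)) (min j q)))
          , k , p , dv

    ⇐ : Level₀ v x → S^ G R (ℤ.+ 0) v x
    ⇐ (x∈S , far , ℓ , p , dv) = x∈S , ℓ , ℓ , (p , min) , dv , ℤ.i≡j⇒i-j≡0 {ℤ.+ ℓ} refl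
      where
      -- Prefixing the edge r x gives ℓ ≤ j + 1, and equality would make x nearer to v than r is.
      min : ∀ j → Walk G x v j → ℓ ≤ j
      min j q with m≤n⇒m<n∨m≡n (proj₂ dv _ (cons (S⊆N x x∈S) q))
      ... | inj₁ ℓ<1+j = s≤s⁻¹ ℓ<1+j
      ... | inj₂ refl  = contradiction (x∈S , j , q , dv) far

  root-near : ∀ {x} → x ∈ S → Near x x
  root-near {x} x∈S = x∈S , 0 , nil , cons (S⊆N x x∈S) nil ,
    λ { zero nil → contradiction (S⊆N x x∈S) (irrefl refl) ; (suc _) _ → s≤s z≤n }

  -- A last edge u v of a shortest walk from r to v.
  Parent : V → V → Set
  Parent v u = ∃[ ℓ ] (IsDist G r u ℓ × IsDist G r v (suc ℓ))

  Sibling : V → V → Set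
  Sibling v u = ∃[ ℓ ] (IsDist G r u ℓ × IsDist G r v ℓ)

  near-child : ∀ {u v x} → u ~ v → Parent v u → Near u x → Near v x
  near-child u~v (ℓ , du , dv) (x∈S , k , p , du′) with refl ← IsMinimum-unique du du′ =
    x∈S , ℓ , snoc p u~v , dv

  -- For a nonempty walk from x, take u to be its penultimate vertex. Going from r through x gives a
  -- walk to u one shorter than d(r , v), and no shorter one exists, since u is adjacent to v.
  near-parent : ∀ {v x} → Near v x → x ≡ v ⊎ ∃[ u ] (v ~ u × Parent v u × Near u x)
  near-parent (x∈S , zero  , nil , _) = inj₁ refl
  near-parent {x = x} (x∈S , suc k , p , dv) =
    let u , q , u~v = unsnoc p
        du : IsDist G r u (suc k)
        du = cons (S⊆N x x∈S) q , λ j q′ → s≤s⁻¹ (proj₂ dv (suc j) (snoc q′ u~v))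
    in inj₂ (u , ~-sym u~v , (suc k , du , dv) , x∈S , k , q , du)

  level₀-sibling : ∀ {u v x} → u ~ v → Sibling v u → ¬ Near v x → Near u x → Level₀ v x
  level₀-sibling u~v (ℓ , du , dv) far (x∈S , k , p , du′) with refl ← IsMinimum-unique du du′ =
    x∈S , far , ℓ , snoc p u~v , dv

  level₀-child : ∀ {u v x} → u ~ v → Parent v u → ¬ Near v x → Level₀ u x → Level₀ v x
  level₀-child u~v (ℓ , du , dv) far (x∈S , _ , k , p , du′) with refl ← IsMinimum-unique du du′ =
    x∈S , far , suc ℓ , snoc p u~v , dv

  -- With u the penultimate vertex of a walk of length k + 1 from x to v, the edges r x and u v
  -- confine d(r , u) to k or k + 1. In the former case x is not near u, or it would be near v as
  -- well. The empty walk would force x = r, which is not a root in S.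
  level₀-neighbour : ∀ {v x} → (∀ {u} → v ~ u → ∃ (IsDist G r u)) → Level₀ v x →
    ∃[ u ] (v ~ u × (Sibling v u × Near u x ⊎ Parent v u × Level₀ u x))
  level₀-neighbour {x = x} dist (x∈S , far , zero , nil , (p , _)) with p
  ... | nil = contradiction (S⊆N x x∈S) (irrefl refl)
  level₀-neighbour {x = x} dist (x∈S , far , suc k , p , dv) with unsnoc p
  ... | u , q , u~v with dist (~-sym u~v)
  ... | ℓ , du with m≤n⇒m<n∨m≡n (proj₂ du _ (cons (S⊆N x x∈S) q))
  ... | inj₂ refl  = u , ~-sym u~v , inj₁ ((suc k , du , dv) , x∈S , k , q , du)
  ... | inj₁ ℓ≤k with refl ← ≤-antisym (s≤s⁻¹ ℓ≤k) (s≤s⁻¹ (proj₂ dv _ (snoc (proj₁ du) u~v))) =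
    u , ~-sym u~v , inj₂ ((k , du , dv) , x∈S , (far ∘ near-child u~v (k , du , dv)) , k , q , du)

-- Words as sets of roots, and the position of a root relative to r

module _ {G : Graph} {r : Graph.V G} {b : ℕ} (R : RootSet G r b) where
  open Graph G using (V; _~_; irrefl) renaming (sym to ~-sym)
  open RootSet R

  Bit : Pred V 0ℓ → Fin b → Set
  Bit P j = ∃[ i ] (toℕ i ≡ toℕ j × P (nth i))

  Bit-map : ∀ {P Q : Pred V 0ℓ} → (∀ {u} → P u → Q u) → ∀ {j} → Bit P j → Bit Q j
  Bit-map f (i , i≡j , p) = i , i≡j , f p

  Represents-resp-⇔ : ∀ {w} {P Q : Pred V 0ℓ} → (∀ {u} → P u ⇔ Q u) →
                      Represents G R w P → Represents G R w Q
  Represents-resp-⇔ {P = P} {Q} P⇔Q rep j = mk⇔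
    (Bit-map {P} {Q} (λ {u} → to (P⇔Q {u})) ∘ to (rep j))
    (from (rep j) ∘ Bit-map {Q} {P} (λ {u} → from (P⇔Q {u})))

  Bit-∩ : ∀ {P Q : Pred V 0ℓ} {j} → Bit P j → Bit Q j → Bit (λ u → P u × Q u) j
  Bit-∩ (i , i≡j , p) (i′ , i′≡j , q) with refl ← toℕ-injective (trans i≡j (sym i′≡j)) =
    i , i≡j , p , q

  -- The bound ∣ S ∣ ≤ b enters here: it gives every root a position inside the word.
  common-bit : ∀ {w w′} (P Q : Pred V 0ℓ) → Represents G R w P → Represents G R w′ Q →
               ∀ {u} → u ∈ S → P u → Q u → Nonempty (w ∩ w′)
  common-bit P Q rep rep′ {u} u∈S p q with to (nth-image u) u∈S
  ... | i , refl = let j = inject≤ i small; i≡j = sym (toℕ-inject≤ i small) in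
    j , x∈p∩q⁺ (from (rep j) (i , i≡j , p) , from (rep′ j) (i , i≡j , q))

  common-element : ∀ {w w′} (P Q : Pred V 0ℓ) → Represents G R w P → Represents G R w′ Q →
                   ∀ {j} → j ∈ w ∩ w′ → ∃[ u ] (P u × Q u)
  common-element P Q rep rep′ {j} j∈ =
    let j∈w , j∈w′ = x∈p∩q⁻ _ _ j∈
        i , _ , p , q = Bit-∩ {P} {Q} (to (rep j) j∈w) (to (rep′ j) j∈w′)
    in nth i , p , q

  S⁻¹-dist : ∀ {v u d} → IsDist G r v d → S^ G R (ℤ.- (ℤ.+ 1)) v u →
             ∃[ x ] (IsDist G u v x × d ≡ suc x)
  S⁻¹-dist dr (_ , x , y , du , dr′ , eq) =
    x , du , trans (IsMinimum-unique dr dr′) (sym (m-n≡-1⇒1+m≡n x y eq))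

  S⁰-dist : ∀ {v u d} → IsDist G r v d → S^ G R (ℤ.+ 0) v u → IsDist G u v d
  S⁰-dist {v} {u} dr (_ , x , y , du , dr′ , eq) = subst (IsDist G u v)
    (trans (ℤ.+-injective (ℤ.i-j≡0⇒i≡j (ℤ.+ x) (ℤ.+ y) eq)) (IsMinimum-unique dr′ dr)) du

  -- Compares x = d(u , v) with d = d(r , v). In `as-far` membership in S⁰ is conditional because u
  -- may be r itself.
  data Offset (v u : V) (d x : ℕ) : Set where
    farther : d < x → Offset v u d x
    as-far  : d ≡ x → (u ∈ S → S^ G R (ℤ.+ 0) v u) → Offset v u d x
    nearer  : d ≡ suc x → u ∈ S → S^ G R (ℤ.- (ℤ.+ 1)) v u → Offset v u d x

  offset : ∀ {v u d x} → u ∈ ⁅ r ⁆ ∪ S → IsDist G r v d → IsDist G u v x → Offset v u d x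
  offset {v} {u} {d} {x} u∈ dr du with x∈p∪q⁻ ⁅ r ⁆ S u∈
  ... | inj₁ u∈r with refl ← x∈⁅y⁆⇒x≡y r u∈r =
    as-far (IsMinimum-unique dr du) (λ r∈S → contradiction (S⊆N r r∈S) (irrefl refl))
  ... | inj₂ u∈S with m≤n⇒m<n∨m≡n (proj₂ dr _ (cons (S⊆N u u∈S) (proj₁ du)))
  ... | inj₂ refl = nearer refl u∈S (u∈S , x , suc x , du , dr , m-[1+m]≡-1 x)
  ... | inj₁ d<1+x with m≤n⇒m<n∨m≡n (s≤s⁻¹ d<1+x)
  ... | inj₁ d<x = farther d<x
  ... | inj₂ refl = as-far refl
    (λ _ → u∈S , d , d , du , dr , ℤ.i≡j⇒i-j≡0 {ℤ.+ d} refl)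

-- Queries

nonzero-true : ∀ {b} (w : Subset b) → Nonempty w → does (nonempty? w) ≡ true
nonzero-true w ne with nonempty? w
... | yes _ = refl
... | no ¬ne = contradiction ne ¬ne

nonzero-false : ∀ {b} (w : Subset b) → ¬ Nonempty w → does (nonempty? w) ≡ false
nonzero-false w ¬ne with nonempty? w
... | yes ne = contradiction ne ¬ne
... | no _ = refl

query : Cmd
query =
  if nonzero (reg 0 and reg 2) ∶ 2 ≔ reg 0 ⊕ reg 1 ⊝ lit 2 ∶
  if nonzero (reg 0 and reg 3 or reg 1 and reg 2) ∶ 2 ≔ reg 0 ⊕ reg 1 ⊝ lit 1 ∶
  (2 ≔ reg 0 ⊕ reg 1)

module _ {G : Graph} {r : Graph.V G} {b : ℕ} (R : RootSet G r b) where
  open Graph G using (V)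
  open RootSet R

  Through : V → V → ℕ → Set
  Through s t k = ∃[ u ] (u ∈ ⁅ r ⁆ ∪ S ×
    (∃₂ λ x y → IsDist G s u x × IsDist G u t y × k ≡ x + y))

  -- Relative to the path through r, a root saves at most one step on each side; the two tests
  -- decide whether a saving of two or one occurs. The longest branch costs 20, within the bound 25.
  query-correct : ∀ {s t : V} {σ : State b} → QueryInput G r R s t σ →
    ∃₂ λ (σ′ : State b) (time : ℕ) →
      ⟨ query , σ ⟩⇓⟨ σ′ , time ⟩ × time ≤ 25 × IsMinimum (Through s t) (regs σ′ nat 2)
  query-correct {s} {t} {σ} input = go
    where
    open QueryInput input
    ds = regs σ nat 0
    dt = regs σ nat 1

    N⁻¹ N⁰ : V → Pred V 0ℓ
    N⁻¹ = S^ G R (ℤ.- (ℤ.+ 1))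
    N⁰  = S^ G R (ℤ.+ 0)

    through-S : ∀ {u x y} → u ∈ S → IsDist G u s x → IsDist G u t y → Through s t (x + y)
    through-S u∈S dx dy = _ , x∈p∪q⁺ (inj₂ u∈S) , _ , _ , IsDist-sym dx , dy , refl

    through-r : Through s t (ds + dt)
    through-r = r , x∈p∪q⁺ (inj₁ (x∈⁅x⁆ r)) , ds , dt , IsDist-sym dist-s , dist-t , refl

    lower-bound : ∀ {k} →
      (∀ {u x y} → Offset R s u ds x → Offset R t u dt y → k ≤ x + y) →
      ∀ j → Through s t j → k ≤ j
    lower-bound bound _ (u , u∈ , x , y , du , dy , refl) =
      bound (offset R u∈ dist-s (IsDist-sym du)) (offset R u∈ dist-t dy)

    ≤1+ : ∀ {u v d x} → Offset R v u d x → d ≤ suc x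
    ≤1+ (farther d<x)    = ≤-trans (<⇒≤ d<x) (n≤1+n _)
    ≤1+ (as-far refl _)   = n≤1+n _
    ≤1+ (nearer refl _ _) = ≤-refl

    go : _
    go with nonempty? (regs σ word 0 ∩ regs σ word 2)
    ... | yes ne@(_ , j∈) with common-element R (N⁻¹ s) (N⁻¹ t) S⁻¹-s S⁻¹-t j∈
    ... | u , p , q with S⁻¹-dist R dist-s p | S⁻¹-dist R dist-t q
    ... | x , dx , ds≡1+x | y , dy , dt≡1+y =
      _ , _ , ⇓if-true (nonzero-true _ ne) ⇓≔ , ≤ᵇ⇒≤ _ 25 _ ,
      subst (Through s t) (sym value) (through-S (proj₁ p) dx dy) , lower-bound bound
      where
      value : ds + dt ∸ 2 ≡ x + y
      value = trans (cong₂ (λ i j → i + j ∸ 2) ds≡1+x dt≡1+y) (cong (_∸ 1) (+-suc x y))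
      bound : ∀ {u x y} → Offset R s u ds x → Offset R t u dt y → ds + dt ∸ 2 ≤ x + y
      bound {x = x} {y} os ot = ≤-trans (∸-monoˡ-≤ 2 (+-mono-≤ (≤1+ os) (≤1+ ot)))
        (≤-reflexive (cong (_∸ 1) (+-suc x y)))
    go | no disjoint with nonempty? (regs σ word 0 ∩ regs σ word 3 ∪ regs σ word 1 ∩ regs σ word 2)
    ... | yes ne@(_ , j∈) =
      _ , _ , ⇓if-false (nonzero-false _ disjoint) (⇓if-true (nonzero-true _ ne) ⇓≔) , ≤ᵇ⇒≤ _ 25 _ ,
      attained (x∈p∪q⁻ _ _ j∈) , lower-bound bound
      where
      attained : ∀ {j} → j ∈ regs σ word 0 ∩ regs σ word 3 ⊎ j ∈ regs σ word 1 ∩ regs σ word 2 →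
                 Through s t (ds + dt ∸ 1)
      attained (inj₁ j∈) with common-element R (N⁻¹ s) (N⁰ t) S⁻¹-s S⁰-t j∈
      ... | u , p , q with S⁻¹-dist R dist-s p
      ... | x , dx , ds≡1+x = subst (Through s t) (sym (cong (λ i → i + dt ∸ 1) ds≡1+x))
        (through-S (proj₁ p) dx (S⁰-dist R dist-t q))
      attained (inj₂ j∈) with common-element R (N⁰ s) (N⁻¹ t) S⁰-s S⁻¹-t j∈
      ... | u , p , q with S⁻¹-dist R dist-t q
      ... | y , dy , dt≡1+y = subst (Through s t)
        (sym (cong (_∸ 1) (trans (cong (ds +_) dt≡1+y) (+-suc ds y))))
        (through-S (proj₁ p) (S⁰-dist R dist-s p) dy)
      bound : ∀ {u d e x y} → Offset R s u d x → Offset R t u e y → d + e ∸ 1 ≤ x + y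
      -- A saving on both sides would set a common bit in the two S⁻¹ words.
      bound (nearer _ u∈S p) (nearer _ _ q) =
        contradiction (common-bit R (N⁻¹ s) (N⁻¹ t) S⁻¹-s S⁻¹-t u∈S p q) disjoint
      bound os (farther d<y)  = ∸-monoˡ-≤ 1 (+-mono-≤ (≤1+ os) (<⇒≤ d<y))
      bound os (as-far refl _) = ∸-monoˡ-≤ 1 (+-monoˡ-≤ _ (≤1+ os))
      bound {x = x} {y} (farther d<x) ot = ≤-trans (∸-monoˡ-≤ 1 (+-mono-≤ (<⇒≤ d<x) (≤1+ ot)))
        (≤-reflexive (cong (_∸ 1) (+-suc x y)))
      bound {d = d} (as-far refl _) ot = ≤-trans (∸-monoˡ-≤ 1 (+-monoʳ-≤ d (≤1+ ot)))
        (≤-reflexive (cong (_∸ 1) (+-suc d _)))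
    go | no disjoint | no disjoint₀ =
      _ , _ , ⇓if-false (nonzero-false _ disjoint) (⇓if-false (nonzero-false _ disjoint₀) ⇓≔) ,
      ≤ᵇ⇒≤ _ 25 _ , through-r , lower-bound bound
      where
      bound : ∀ {u d e x y} → Offset R s u d x → Offset R t u e y → d + e ≤ x + y
      bound (nearer _ u∈S p) (nearer _ _ q) =
        contradiction (common-bit R (N⁻¹ s) (N⁻¹ t) S⁻¹-s S⁻¹-t u∈S p q) disjoint
      bound (nearer _ u∈S p) (as-far _ q) =
        let j , j∈ = common-bit R (N⁻¹ s) (N⁰ t) S⁻¹-s S⁰-t u∈S p (q u∈S)
        in contradiction (j , x∈p∪q⁺ (inj₁ j∈)) disjoint₀
      bound (as-far _ p) (nearer _ u∈S q) =
        let j , j∈ = common-bit R (N⁰ s) (N⁻¹ t) S⁰-s S⁻¹-t u∈S (p u∈S) q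
        in contradiction (j , x∈p∪q⁺ (inj₂ j∈)) disjoint₀
      -- Since both tests failed, a step saved on one side is lost again on the other.
      bound {e = e} {x} (nearer refl _ _) (farther e<y) =
        ≤-trans (≤-reflexive (sym (+-suc x e))) (+-monoʳ-≤ x e<y)
      bound {d = d} {y = y} (farther d<x) (nearer refl _ _) =
        ≤-trans (≤-reflexive (+-suc d y)) (+-monoˡ-≤ y d<x)
      bound (farther d<x) (farther e<y) = +-mono-≤ (<⇒≤ d<x) (<⇒≤ e<y)
      bound (farther d<x) (as-far refl _) = +-monoˡ-≤ _ (<⇒≤ d<x)
      bound (as-far refl _) (farther e<y) = +-monoʳ-≤ _ (<⇒≤ e<y)
      bound (as-far refl _) (as-far refl _) = ≤-refl

-- Memory and loops

≡⇒≡ᵇ-true : ∀ {j k} → j ≡ k → (j ≡ᵇ k) ≡ true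
≡⇒≡ᵇ-true {zero}  refl = refl
≡⇒≡ᵇ-true {suc j} refl = ≡⇒≡ᵇ-true {j} refl

≢⇒≡ᵇ-false : ∀ {j k} → j ≢ k → (j ≡ᵇ k) ≡ false
≢⇒≡ᵇ-false {zero}  {zero}  j≢k = contradiction refl j≢k
≢⇒≡ᵇ-false {zero}  {suc k} j≢k = refl
≢⇒≡ᵇ-false {suc j} {zero}  j≢k = refl
≢⇒≡ᵇ-false {suc j} {suc k} j≢k = ≢⇒≡ᵇ-false (j≢k ∘ cong suc)

<⇒<ᵇ-true : ∀ {j k} → j < k → (j <ᵇ k) ≡ true
<⇒<ᵇ-true {zero}  (s≤s _)   = refl
<⇒<ᵇ-true {suc j} (s≤s j<k) = <⇒<ᵇ-true j<k

<ᵇ-irrefl : ∀ k → (k <ᵇ k) ≡ false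
<ᵇ-irrefl zero    = refl
<ᵇ-irrefl (suc k) = <ᵇ-irrefl k

module _ {A : Set} (f : ℕ → A) where

  update-at : ∀ {i j a} → i ≡ j → (f [ i ↦ a ]) j ≡ a
  update-at {i} refl rewrite ≡⇒≡ᵇ-true {i} refl = refl

  update-away : ∀ {i j a} → i ≢ j → (f [ i ↦ a ]) j ≡ f j
  update-away i≢j rewrite ≢⇒≡ᵇ-false i≢j = refl

Runs : ∀ {b} → Cmd → State b → ℕ → (State b → Set) → Set
Runs p σ k Q = ∃₂ λ σ′ t → ⟨ p , σ ⟩⇓⟨ σ′ , t ⟩ × t ≤ k × Q σ′

-- The part of the memory that the loops below leave to their bodies: all but
-- the input, the loop variables and the number registers that are unused.
record View (b : ℕ) : Set where
  constructor mkView
  field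
    tail            : ℕ
    dists levels queue : ℕ → ℕ
    acc             : Subset b
    words           : ℕ → ℕ → Subset b

view : ∀ {b} → State b → View b
view σ = record
  { tail   = regs σ nat 4
  ; dists  = arrays σ nat 4
  ; levels = arrays σ nat 5
  ; queue  = arrays σ nat 6
  ; acc    = regs σ word 0
  ; words  = arrays σ word
  }

-- The constructors leave the sort implicit; these four abbreviations fix it where the context does
-- not.
natAt : ℕ → Exp nat → Exp nat
natAt x e = x [ e ]

wordAt : ℕ → Exp nat → Exp word
wordAt x e = x [ e ]

natReg : ℕ → Exp nat
natReg = reg

wordReg : ℕ → Exp word
wordReg = reg

foreach : Cmd → Cmd
foreach body = while lit 0 ≺ reg 6 ∶ (7 ≔ natAt 1 (reg 6) ⨾ body ⨾ 6 ≔ natAt 2 (reg 6))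

-- Registers: 3 is the number of processed vertices, 4 the length of the queue
-- (array 6), 5 the current vertex, 6 a cell of its adjacency list and 7 the
-- neighbour in that cell.
sweep : Cmd → Cmd → Cmd → Cmd
sweep pre body post = while reg 3 ≺ reg 4 ∶
  ( 5 ≔ natAt 6 (reg 3) ⨾ pre ⨾ 6 ≔ natAt 0 (reg 5) ⨾ foreach body ⨾ post ⨾ 3 ≔ reg 3 ⊕ lit 1 )

-- Loops over an adjacency list and over the queue

module Loops {b : ℕ} {G : Graph} (A : AdjacencyLists G) (heads value next : ℕ → ℕ)
  (adjacency : ∀ v → LinkedList value next (heads (toℕ v)) (map toℕ (AdjacencyLists.nbrs A v))) where
  open Graph G using (V; n; m)
  open AdjacencyLists A

  Entry : Set
  Entry = V × ℕ

  Stored : State b → Set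
  Stored σ = arrays σ nat 0 ≡ heads × arrays σ nat 1 ≡ value × arrays σ nat 2 ≡ next

  Context : (i v p : ℕ) → State b → Set
  Context i v p σ = regs σ nat 3 ≡ i × regs σ nat 5 ≡ v × regs σ nat 6 ≡ p × Stored σ

  -- Contains the frame condition: the command hands back the loop registers and the stored graph as
  -- it found them, for whatever cell register 6 points to.
  Step : (i v k : ℕ) → Cmd → State b → (View b → Set) → Set
  Step i v k c σ Q = ∀ {p} → Context i v p σ → Runs c σ k (λ σ′ → Context i v p σ′ × Q (view σ′))

  -- A generous common bound for all loop bodies; the dearest run, through both tests of
  -- `visit-level`, costs 19.
  stepCost : ℕ
  stepCost = 40

  BodySpec : Cmd → V → (List V → View b → Set) → Set
  BodySpec body v I = ∀ {i x xs} (σ : State b) → regs σ nat 7 ≡ toℕ x → I (x ∷ xs) (view σ) →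
    Step i (toℕ v) stepCost body σ (I xs)

  -- Besides the body, a round pays 10: 4 for the loop test and 3 for each of the two reads. The
  -- failing test at the null pointer costs the final 4.
  foreach-runs : ∀ {body v} (I : List V → View b → Set) → BodySpec body v I →
    ∀ {i p} xs σ → LinkedList value next p (map toℕ xs) → Context i (toℕ v) p σ → I xs (view σ) →
    Runs (foreach body) σ ((10 + stepCost) * length xs + 4)
      (λ σ′ → (∃[ q ] Context i (toℕ v) q σ′) × I [] (view σ′))
  foreach-runs I spec [] σ null ctx@(_ , _ , p≡ , _) inv =
    _ , _ , ⇓while-false (cong (0 <ᵇ_) p≡) , ≤ᵇ⇒≤ 4 _ _ , (_ , ctx) , inv
  foreach-runs I spec (x ∷ xs) σ (cell {p = q} value≡ rest) ctx@(_ , _ , p≡ , _ , val≡ , _) inv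
    with spec {xs = xs} (setReg σ nat 7 (arrays σ nat 1 (regs σ nat 6)))
           (trans (cong (λ f → f (regs σ nat 6)) val≡) (trans (cong value p≡) value≡)) inv ctx
  ... | σ₁ , t , body⇓ , t≤stepCost , (i≡ , v≡ , q≡ , stored@(_ , _ , next≡)) , inv₁
    with foreach-runs I spec xs (setReg σ₁ nat 6 (arrays σ₁ nat 2 (regs σ₁ nat 6))) rest
           (i≡ , v≡ , trans (cong (λ f → f (regs σ₁ nat 6)) next≡) (cong next q≡) , stored) inv₁
  ... | σ₂ , u , loop⇓ , u≤ , result =
    σ₂ , _ , ⇓while-true (cong (0 <ᵇ_) p≡) (⇓⨾ ⇓≔ (⇓⨾ body⇓ ⇓≔)) loop⇓ , time , result
    where
    time : suc (3 + (3 + (t + 3)) + u) ≤ (10 + stepCost) * suc (length xs) + 4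
    time = begin
      suc (3 + (3 + (t + 3)) + u)
        ≤⟨ +-mono-≤ (+-monoʳ-≤ 7 (+-monoˡ-≤ 3 t≤stepCost)) u≤ ⟩
      7 + (stepCost + 3) + ((10 + stepCost) * length xs + 4)             ≡⟨ regroup (length xs) ⟩
      (10 + stepCost) * suc (length xs) + 4                       ∎
      where
      open ≤-Reasoning
      regroup : ∀ l → 7 + (40 + 3) + ((10 + 40) * l + 4) ≡ (10 + 40) * suc l + 4
      regroup = solve-∀

  weight : List Entry → ℕ
  weight es = sum (map (λ e → suc (degree A (proj₁ e))) es)

  weight-∷ʳ : ∀ es e → weight (es ∷ʳ e) ≡ weight es + suc (degree A (proj₁ e))
  weight-∷ʳ es e = trans (cong sum (map-++ _ es (e ∷ [])))
    (trans (sum-++ (map _ es) _) (cong (weight es +_) (+-identityʳ _)))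

  -- Charged per unit of `weight`. Visiting a vertex of degree d costs at most 98 + 50 d, below 150
  -- (1 + d).
  visitCost : ℕ
  visitCost = 150

  module Sweep {pre body post : Cmd}
    (J : List Entry → List Entry → View b → Set)
    (I : List Entry → Entry → List V → View b → Set)
    (bounded : ∀ {done todo w} → J done todo w → length done ≤ n)
    (tail-index : ∀ {done todo w} → J done todo w → View.tail w ≡ length (done ++ todo))
    (queue-head : ∀ {done e todo w} → J done (e ∷ todo) w →
                  View.queue w (length done) ≡ toℕ (proj₁ e))
    (pre-spec : ∀ {done e todo i} (σ : State b) → J done (e ∷ todo) (view σ) →
                Step i (toℕ (proj₁ e)) stepCost pre σ (I done e (nbrs (proj₁ e))))
    (body-spec : ∀ {done e} → BodySpec body (proj₁ e) (I done e))
    (post-spec : ∀ {done e i} (σ : State b) → I done e [] (view σ) →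
                Step i (toℕ (proj₁ e)) stepCost post σ (λ w → ∃[ todo ] J (done ∷ʳ e) todo w))
    where

    -- The list `all` is known only when the loop ends, so the remaining time is bounded by the
    -- difference of two weights; visits then telescope.
    Result : List Entry → State b → Set
    Result done σ = ∃₂ λ σ′ t → ∃[ all ] (⟨ sweep pre body post , σ ⟩⇓⟨ σ′ , t ⟩ ×
      t + weight done * visitCost ≤ weight all * visitCost + 4 × Stored σ′ × J all [] (view σ′))

    private
      length-∷ʳ : ∀ (done : List Entry) e → length (done ∷ʳ e) ≡ suc (length done)
      length-∷ʳ done e = trans (length-++ done) (+-comm (length done) 1)

    sweep-from : ∀ fuel done todo σ → length done + fuel ≡ suc n →
      regs σ nat 3 ≡ length done → Stored σ → J done todo (view σ) → Result done σ
    sweep-from _ done [] σ _ i≡ stored j =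
      σ , 4 , done , ⇓while-false test≡ , ≤-reflexive (+-comm 4 _) , stored , j
      where
      test≡ : (regs σ nat 3 <ᵇ regs σ nat 4) ≡ false
      test≡ rewrite i≡ | tail-index j | length-++ done {[]} | +-identityʳ (length done) =
        <ᵇ-irrefl (length done)
    sweep-from zero done (_ ∷ _) σ fuel≡ i≡ stored j =
      contradiction (bounded j) (<⇒≱ (≤-reflexive (trans (sym fuel≡) (+-identityʳ _))))
    sweep-from (suc fuel) done (e ∷ todo) σ fuel≡ i≡ stored@(heads≡ , _) j
      with pre-spec (setReg σ nat 5 (arrays σ nat 6 (regs σ nat 3))) j
             (i≡ , trans (cong (arrays σ nat 6) i≡) (queue-head j) , refl , stored)
    ... | σ₁ , t₁ , pre⇓ , t₁≤ , (i≡₁ , v≡₁ , _ , stored₁@(heads≡₁ , _)) , inv₁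
      with foreach-runs (I done e) body-spec (nbrs (proj₁ e))
             (setReg σ₁ nat 6 (arrays σ₁ nat 0 (regs σ₁ nat 5))) (adjacency (proj₁ e))
             (i≡₁ , v≡₁ , trans (cong (λ f → f (regs σ₁ nat 5)) heads≡₁) (cong heads v≡₁) , stored₁) inv₁
    ... | σ₂ , t₂ , foreach⇓ , t₂≤ , (_ , ctx₂) , inv₂
      with post-spec σ₂ inv₂ ctx₂
    ... | σ₃ , t₃ , post⇓ , t₃≤ , (i≡₃ , _ , _ , stored₃) , todo′ , j₃
      with sweep-from fuel (done ∷ʳ e) todo′ (setReg σ₃ nat 3 (regs σ₃ nat 3 + 1))
             (trans (cong (_+ fuel) (length-∷ʳ done e)) (trans (sym (+-suc (length done) fuel)) fuel≡))
             (trans (cong (_+ 1) i≡₃) (sym (length-++ done))) stored₃ j₃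
    ... | σ₄ , t₄ , all , loop⇓ , t₄≤ , result =
      σ₄ , _ , all ,
      ⇓while-true test≡ (⇓⨾ ⇓≔ (⇓⨾ pre⇓ (⇓⨾ ⇓≔ (⇓⨾ foreach⇓ (⇓⨾ post⇓ ⇓≔))))) loop⇓ ,
      time , result
      where
      test≡ : (regs σ nat 3 <ᵇ regs σ nat 4) ≡ true
      test≡ rewrite i≡ | tail-index j | length-++ done {e ∷ todo} =
        <⇒<ᵇ-true (m<m+n (length done) (s≤s z≤n))
      d = degree A (proj₁ e)
      visit-time : 14 + (t₁ + t₂ + t₃) ≤ suc d * visitCost
      visit-time = begin
        14 + (t₁ + t₂ + t₃)
          ≤⟨ +-monoʳ-≤ 14 (+-mono-≤ (+-mono-≤ t₁≤ t₂≤) t₃≤) ⟩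
        14 + (stepCost + ((10 + stepCost) * d + 4) + stepCost)
          ≡⟨ regroup d ⟩
        98 + d * 50
          ≤⟨ +-mono-≤ (≤ᵇ⇒≤ 98 visitCost _) (*-monoʳ-≤ d (≤ᵇ⇒≤ 50 visitCost _)) ⟩
        suc d * visitCost                         ∎
        where
        open ≤-Reasoning
        regroup : ∀ d → 14 + (40 + ((10 + 40) * d + 4) + 40) ≡ 98 + d * 50
        regroup = solve-∀
      time : suc (3 + (3 + (t₁ + (3 + (t₂ + (t₃ + 4))))) + t₄) + weight done * visitCost
             ≤ weight all * visitCost + 4
      time = begin
        suc (3 + (3 + (t₁ + (3 + (t₂ + (t₃ + 4))))) + t₄) + weight done * visitCost
          ≡⟨ regroup t₁ t₂ t₃ t₄ (weight done * visitCost) ⟩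
        t₄ + (weight done * visitCost + (14 + (t₁ + t₂ + t₃)))
          ≤⟨ +-monoʳ-≤ t₄ (+-monoʳ-≤ (weight done * visitCost) visit-time) ⟩
        t₄ + (weight done * visitCost + suc d * visitCost)
          ≡⟨ cong (t₄ +_) (*-distribʳ-+ visitCost (weight done) (suc d)) ⟨
        t₄ + (weight done + suc d) * visitCost
          ≡⟨ cong (λ k → t₄ + k * visitCost) (weight-∷ʳ done e) ⟨
        t₄ + weight (done ∷ʳ e) * visitCost
          ≤⟨ t₄≤ ⟩
        weight all * visitCost + 4                 ∎
        where
        open ≤-Reasoning
        regroup : ∀ a b c d w → suc (3 + (3 + (a + (3 + (b + (c + 4))))) + d) + w
                                ≡ d + (w + (14 + (a + b + c)))
        regroup = solve-∀

    sweep-runs : ∀ {todo} σ → regs σ nat 3 ≡ 0 → Stored σ → J [] todo (view σ) →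
      ∃[ all ] Runs (sweep pre body post) σ (weight all * visitCost + 4)
                 (λ σ′ → Stored σ′ × J all [] (view σ′))
    sweep-runs σ i≡ stored j with sweep-from (suc n) [] _ σ refl i≡ stored j
    ... | σ′ , t , all , sweep⇓ , t≤ , result =
      all , σ′ , t , sweep⇓ , ≤-trans (m≤m+n t _) t≤ , result

-- The search from r

module _ {a ℓ : Level} {A : Set a} {R : Rel A ℓ} where

  AllPairs-drop : ∀ xs {ys} → AllPairs R (xs ++ ys) → AllPairs R ys
  AllPairs-drop []       pairs       = pairs
  AllPairs-drop (_ ∷ xs) (_ ∷ pairs) = AllPairs-drop xs pairs

  AllPairs-across : ∀ {x y} xs {ys} → AllPairs R (xs ++ ys) → x List.∈ xs → y List.∈ ys → R x y
  AllPairs-across (_ ∷ xs) (all ∷ _)   (here refl) y∈ = All.lookup all (∈-++⁺ʳ xs y∈)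
  AllPairs-across (_ ∷ xs) (_ ∷ pairs) (there x∈)  y∈ = AllPairs-across xs pairs x∈ y∈

  AllPairs-∷ʳ : ∀ {xs y} → AllPairs R xs → (∀ {x} → x List.∈ xs → R x y) → AllPairs R (xs ∷ʳ y)
  AllPairs-∷ʳ pairs all = AllPairs.++⁺ pairs ([] ∷ []) (All.tabulate (λ x∈ → all x∈ ∷ []))

∈-∷ʳ⁻ : ∀ {a} {A : Set a} {x y : A} xs → x List.∈ xs ∷ʳ y → x List.∈ xs ⊎ x ≡ y
∈-∷ʳ⁻ xs x∈ with ∈-++⁻ xs x∈
... | inj₁ x∈xs        = inj₁ x∈xs
... | inj₂ (here x≡y) = inj₂ x≡y

∈-∷ʳ⁺ : ∀ {a} {A : Set a} {y : A} xs → y List.∈ xs ∷ʳ y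
∈-∷ʳ⁺ xs = ∈-++⁺ʳ xs (here refl)

Distinct : ∀ {V : Set} → List (V × ℕ) → Set
Distinct = AllPairs (λ x y → proj₁ x ≢ proj₁ y)

length-prefix≤n : ∀ {n} {es : List (Fin n × ℕ)} done {todo} → Distinct es → es ≡ done ++ todo →
                  length done ≤ n
length-prefix≤n {n} {es} done {todo} distinct split = begin
  length done               ≤⟨ m≤m+n _ _ ⟩
  length done + length todo ≡⟨ trans (cong length split) (length-++ done) ⟨
  length es                 ≡⟨ length-map proj₁ es ⟨
  length (map proj₁ es)     ≤⟨ length-unique-Fin (AllPairs.map⁺ distinct) ⟩
  n                         ∎
  where open ≤-Reasoning

ByLevel : ∀ {V : Set} → List (V × ℕ) → Set
ByLevel = AllPairs (λ x y → proj₂ x ≤ proj₂ y)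

module _ (G : Graph) (r : Graph.V G) where
  open Graph G using (V; n; _~_) renaming (sym to ~-sym)

  -- The vertices enqueued so far, with their levels: those in done have been
  -- scanned, those in todo have not.
  record Frontier (done todo es : List (V × ℕ)) : Set where
    field
      split    : es ≡ done ++ todo
      distinct : Distinct es
      sorted   : ByLevel es
      narrow   : ∀ {x y} → x List.∈ es → y List.∈ todo → proj₂ x ≤ suc (proj₂ y)
      walk     : ∀ {v ℓ} → (v , ℓ) List.∈ es → Walk G r v ℓ
      closed   : ∀ {v ℓ u} → (v , ℓ) List.∈ done → v ~ u →
                 ∃[ ℓ′ ] ((u , ℓ′) List.∈ es × ℓ′ ≤ suc ℓ)
      start    : (r , 0) List.∈ es

    todo⊆es : ∀ {e} → e List.∈ todo → e List.∈ es
    todo⊆es e∈ = subst (_ List.∈_) (sym split) (∈-++⁺ʳ done e∈)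

  frontier₀ : Frontier [] ((r , 0) ∷ []) ((r , 0) ∷ [])
  frontier₀ = record
    { split    = refl
    ; distinct = [] ∷ []
    ; sorted   = [] ∷ []
    ; narrow   = λ { (here refl) _ → z≤n }
    ; walk     = λ { (here refl) → nil }
    ; closed   = λ ()
    ; start    = here refl
    }

  -- `sorted` and `narrow` support each other: by `narrow` no level exceeds ℓ + 1, so the new entry
  -- may stand last; by `sorted` ℓ is the least pending level, so the new entry is at most one above
  -- every pending one.
  enqueue : ∀ {done v ℓ todo es u} → Frontier done ((v , ℓ) ∷ todo) es → v ~ u →
            (∀ {ℓ′} → ¬ ((u , ℓ′) List.∈ es)) →
            Frontier done ((v , ℓ) ∷ (todo ∷ʳ (u , suc ℓ))) (es ∷ʳ (u , suc ℓ))
  enqueue {done} {v} {ℓ} {todo} {es} {u} F v~u u∉ = record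
    { split    = trans (cong (_∷ʳ _) split) (++-assoc done ((v , ℓ) ∷ todo) _)
    ; distinct = AllPairs-∷ʳ distinct (λ { x∈ refl → u∉ x∈ })
    ; sorted   = AllPairs-∷ʳ sorted (λ x∈ → narrow x∈ (here refl))
    ; narrow   = λ x∈ y∈ → narrow′ (∈-∷ʳ⁻ es x∈) (∈-∷ʳ⁻ ((v , ℓ) ∷ todo) y∈)
    ; walk     = λ x∈ → walk′ (∈-∷ʳ⁻ es x∈)
    ; closed   = λ x∈ e → let ℓ′ , u∈ , ≤ = closed x∈ e in ℓ′ , ∈-++⁺ˡ u∈ , ≤
    ; start    = ∈-++⁺ˡ start
    }
    where
    open Frontier F
    first : ∀ {y} → y List.∈ (v , ℓ) ∷ todo → ℓ ≤ proj₂ y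
    first (here refl) = ≤-refl
    first (there y∈) with all ∷ _ ← AllPairs-drop done (subst ByLevel split sorted) =
      All.lookup all y∈

    narrow′ : ∀ {x y} → x List.∈ es ⊎ x ≡ (u , suc ℓ) →
              y List.∈ (v , ℓ) ∷ todo ⊎ y ≡ (u , suc ℓ) → proj₂ x ≤ suc (proj₂ y)
    narrow′ (inj₁ x∈)   (inj₁ y∈)   = narrow x∈ y∈
    narrow′ (inj₁ x∈)   (inj₂ refl) = ≤-trans (narrow x∈ (here refl)) (n≤1+n _)
    narrow′ (inj₂ refl) (inj₁ y∈)   = s≤s (first y∈)
    narrow′ (inj₂ refl) (inj₂ refl) = n≤1+n _

    walk′ : ∀ {w k} → (w , k) List.∈ es ⊎ (w , k) ≡ (u , suc ℓ) → Walk G r w k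
    walk′ (inj₁ x∈)   = walk x∈
    walk′ (inj₂ refl) = snoc (walk (todo⊆es (here refl))) v~u

  dequeue : ∀ {done v ℓ todo es} → Frontier done ((v , ℓ) ∷ todo) es →
            (∀ {u} → v ~ u → ∃[ ℓ′ ] ((u , ℓ′) List.∈ es × ℓ′ ≤ suc ℓ)) →
            Frontier (done ∷ʳ (v , ℓ)) todo es
  dequeue {done} {v} {ℓ} {todo} {es} F scanned = record
    { split    = trans split (sym (∷ʳ-++ done _ todo))
    ; distinct = distinct
    ; sorted   = sorted
    ; narrow   = λ x∈ y∈ → narrow x∈ (there y∈)
    ; walk     = walk
    ; closed   = λ x∈ → closed′ (∈-∷ʳ⁻ done x∈)
    ; start    = start
    }
    where
    open Frontier F
    closed′ : ∀ {w k u} → (w , k) List.∈ done ⊎ (w , k) ≡ (v , ℓ) → w ~ u →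
              ∃[ ℓ′ ] ((u , ℓ′) List.∈ es × ℓ′ ≤ suc k)
    closed′ (inj₁ x∈)   = closed x∈
    closed′ (inj₂ refl) = scanned

  record LevelOrder (es : List (V × ℕ)) : Set where
    field
      distinct : Distinct es
      sorted   : ByLevel es
      dist     : ∀ {v ℓ} → (v , ℓ) List.∈ es → IsDist G r v ℓ
      reached  : ∀ {v} → Reachable G r v → ∃[ ℓ ] ((v , ℓ) List.∈ es)

    neighbour : ∀ {v ℓ u} → (v , ℓ) List.∈ es → v ~ u → ∃[ ℓ′ ] ((u , ℓ′) List.∈ es)
    neighbour v∈ v~u = reached (_ , snoc (proj₁ (dist v∈)) v~u)

    -- Makes processing in queue order sound: when a vertex collects from a parent, the word of the
    -- parent is final.
    nearer-first : ∀ {done e todo x} → es ≡ done ++ e ∷ todo → x List.∈ es →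
                   proj₂ x < proj₂ e → x List.∈ done
    nearer-first {done} {e} {todo} split x∈ x<e with ∈-++⁻ done (subst (_ List.∈_) split x∈)
    ... | inj₁ x∈done      = x∈done
    ... | inj₂ (here refl) = contradiction x<e (<-irrefl refl)
    ... | inj₂ (there x∈todo) with all ∷ _ ← AllPairs-drop done (subst ByLevel split sorted) =
      contradiction x<e (≤⇒≯ (All.lookup all x∈todo))

    not-done : ∀ {done e todo x} → es ≡ done ++ e ∷ todo → x List.∈ done → proj₁ e ≢ proj₁ x
    not-done {done} split x∈ =
      AllPairs-across done (subst Distinct split distinct) x∈ (here refl) ∘ sym

  -- With nothing pending, every entry is closed. Following any walk of length k from r therefore
  -- meets entries whose levels rise by at most one per edge, ending at a level at most k.
  levelOrder : ∀ {done es} → Frontier done [] es → LevelOrder es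
  levelOrder {done} {es} F = record
    { distinct = distinct
    ; sorted   = sorted
    ; dist     = λ v∈ → walk v∈ , minimal v∈
    ; reached  = λ (_ , p) → let ℓ , v∈ , _ = along start p in ℓ , v∈
    }
    where
    open Frontier F
    along : ∀ {u ℓ v k} → (u , ℓ) List.∈ es → Walk G u v k →
            ∃[ ℓ′ ] ((v , ℓ′) List.∈ es × ℓ′ ≤ ℓ + k)
    along u∈ nil = _ , u∈ , m≤m+n _ 0
    along {ℓ = ℓ} {k = suc k} u∈ (cons e p) =
      let ℓ₁ , w∈ , ℓ₁≤ = closed (subst (_ List.∈_) (trans split (++-identityʳ done)) u∈) e
          ℓ₂ , v∈ , ℓ₂≤ = along w∈ p
      in ℓ₂ , v∈ , ≤-trans ℓ₂≤ (≤-trans (+-monoˡ-≤ k ℓ₁≤) (≤-reflexive (sym (+-suc ℓ k))))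

    same : ∀ {es : List (V × ℕ)} {v k ℓ} → Distinct es → (v , k) List.∈ es → (v , ℓ) List.∈ es → k ≡ ℓ
    same _         (here refl) (here refl) = refl
    same (all ∷ _) (here refl) (there q)   = contradiction refl (All.lookup all q)
    same (all ∷ _) (there p)   (here refl) = contradiction refl (All.lookup all p)
    same (_ ∷ d)   (there p)   (there q)   = same d p q

    minimal : ∀ {v ℓ} → (v , ℓ) List.∈ es → ∀ k → Walk G r v k → ℓ ≤ k
    minimal v∈ k p with along start p
    ... | ℓ′ , v∈′ , ℓ′≤k rewrite same distinct v∈ v∈′ = ℓ′≤k

QueueArray : ∀ {n} → (ℕ → ℕ) → List (Fin n × ℕ) → Set
QueueArray q []             = ⊤
QueueArray q ((v , _) ∷ es) = q 0 ≡ toℕ v × QueueArray (q ∘ suc) es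

queue-lookup : ∀ {n} {q : ℕ → ℕ} (done : List (Fin n × ℕ)) {e todo} →
               QueueArray q (done ++ e ∷ todo) → q (length done) ≡ toℕ (proj₁ e)
queue-lookup []         (q≡ , _) = q≡
queue-lookup (_ ∷ done) (_ , qs) = queue-lookup done qs

queue-∷ʳ : ∀ {n} {q : ℕ → ℕ} (es : List (Fin n × ℕ)) {u ℓ k i} → i ≡ length es → k ≡ toℕ u →
           QueueArray q es → QueueArray (q [ i ↦ k ]) (es ∷ʳ (u , ℓ))
queue-∷ʳ []       refl refl _        = refl , tt
queue-∷ʳ (_ ∷ es) refl refl (q≡ , qs) = q≡ , queue-∷ʳ es refl refl qs

-- Levels are stored increased by one: 0 marks the vertices not yet reached.
LevelArray : ∀ {n} → (ℕ → ℕ) → List (Fin n × ℕ) → Set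
LevelArray f es = ∀ {v ℓ} → (v , ℓ) List.∈ es → f (toℕ v) ≡ suc ℓ

visit : Cmd
visit = if natAt 5 (reg 7) ≐ lit 0 ∶
  (5 [ reg 7 ]≔ natAt 5 (reg 5) ⊕ lit 1 ⨾ 6 [ reg 4 ]≔ natReg 7 ⨾ 4 ≔ reg 4 ⊕ lit 1) ∶
  skip

-- `B` stands for the facts about the marks of the roots, which the search carries through without
-- inspecting them.
module BFS {b : ℕ} {G : Graph} (A : AdjacencyLists G) (heads value next : ℕ → ℕ)
  (adjacency : ∀ v → LinkedList value next (heads (toℕ v)) (map toℕ (AdjacencyLists.nbrs A v)))
  (r : Graph.V G) (B : (ℕ → Subset b) → Set) where
  open Graph G using (V; n; m; _~_)
  open AdjacencyLists A using (nbrs; complete)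
  open Loops {b} A heads value next adjacency

  record Inv (done todo : List Entry) (w : View b) : Set where
    open View w
    field
      es        : List Entry
      frontier  : Frontier G r done todo es
      level     : LevelArray levels es
      unvisited : ∀ v → (∃[ ℓ ] ((v , ℓ) List.∈ es)) ⊎ levels (toℕ v) ≡ 0
      queued    : QueueArray queue es
      tail≡     : tail ≡ length es
      bits      : B (words 2)

  record Scan (done : List Entry) (e : Entry) (xs : List V) (w : View b) : Set where
    field
      todo     : List Entry
      inv      : Inv done (e ∷ todo) w
    open Inv inv public
    field
      scanned  : ∀ {u} → proj₁ e ~ u → u List.∈ xs ⊎ ∃[ ℓ ] ((u , ℓ) List.∈ es × ℓ ≤ suc (proj₂ e))
      adjacent : All (proj₁ e ~_) xs

  visit-spec : ∀ {done e} → BodySpec visit (proj₁ e) (Scan done e)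
  visit-spec {done} {v , ℓ} {x = x} {xs} σ x≡ scan ctx@(_ , v≡ , _) with Scan.unvisited scan x
  ... | inj₁ (ℓ′ , x∈) =
    _ , _ , ⇓if-false (cong (_≡ᵇ 0) (trans (cong (arrays σ nat 5) x≡) (level x∈))) ⇓skip ,
    ≤ᵇ⇒≤ _ stepCost _ , ctx , record
      { todo     = todo
      ; inv      = inv
      ; scanned  = seen ∘ scanned
      ; adjacent = All.tail adjacent
      }
    where
    open Scan scan
    open Frontier frontier using (narrow)
    seen : ∀ {u} → u List.∈ x ∷ xs ⊎ ∃[ k ] ((u , k) List.∈ es × k ≤ suc ℓ) →
           u List.∈ xs ⊎ ∃[ k ] ((u , k) List.∈ es × k ≤ suc ℓ)
    -- A neighbour found earlier may have any level up to ℓ + 1; `narrow` with v still pending gives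
    -- this bound.
    seen (inj₁ (here refl)) = inj₂ (ℓ′ , x∈ , narrow x∈ (here refl))
    seen (inj₁ (there u∈))  = inj₁ u∈
    seen (inj₂ u∈)          = inj₂ u∈
  ... | inj₂ unseen =
    _ , _ , ⇓if-true (cong (_≡ᵇ 0) (trans (cong (arrays σ nat 5) x≡) unseen))
              (⇓⨾ ⇓[]≔ (⇓⨾ ⇓[]≔ ⇓≔)) ,
    ≤ᵇ⇒≤ _ stepCost _ , ctx , record
      { todo     = todo ∷ʳ (x , suc ℓ)
      ; inv      = record
        { es        = es ∷ʳ (x , suc ℓ)
        ; frontier  = enqueue G r frontier (All.head adjacent) x∉
        ; level     = level′ ∘ ∈-∷ʳ⁻ es
        ; unvisited = unvisited′
        ; queued    = queue-∷ʳ es tail≡ x≡ queued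
        ; tail≡     = trans (cong (_+ 1) tail≡) (sym (length-++ es))
        ; bits      = bits
        }
      ; scanned  = seen ∘ scanned
      ; adjacent = All.tail adjacent
      }
    where
    open Scan scan
    L = arrays σ nat 5
    x∉ : ∀ {k} → ¬ ((x , k) List.∈ es)
    x∉ x∈ = contradiction (trans (sym unseen) (level x∈)) λ ()
    L′ : ℕ → ℕ
    L′ = L [ regs σ nat 7 ↦ L (regs σ nat 5) + 1 ]
    -- Level ℓ + 1 in the shifted storage, obtained by adding one to the stored level of v.
    at-x : L′ (toℕ x) ≡ suc (suc ℓ)
    at-x = trans (update-at L x≡) (trans (cong (λ i → L i + 1) v≡)
      (trans (cong (_+ 1) (level (Frontier.todo⊆es frontier (here refl)))) (+-comm (suc ℓ) 1)))
    away : ∀ {u} → u ≢ x → L′ (toℕ u) ≡ L (toℕ u)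
    away u≢x = update-away L (λ i≡u → u≢x (toℕ-injective (trans (sym i≡u) x≡)))
    level′ : ∀ {u k} → (u , k) List.∈ es ⊎ (u , k) ≡ (x , suc ℓ) → L′ (toℕ u) ≡ suc k
    level′ (inj₁ u∈)   = trans (away λ { refl → x∉ u∈ }) (level u∈)
    level′ (inj₂ refl) = at-x
    unvisited′ : ∀ u → (∃[ k ] ((u , k) List.∈ es ∷ʳ (x , suc ℓ))) ⊎ L′ (toℕ u) ≡ 0
    unvisited′ u with u ≟F x | unvisited u
    ... | yes refl | _                = inj₁ (_ , ∈-∷ʳ⁺ es)
    ... | no _     | inj₁ (k , u∈)    = inj₁ (k , ∈-++⁺ˡ u∈)
    ... | no u≢x   | inj₂ Lu≡0        = inj₂ (trans (away u≢x) Lu≡0)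
    seen : ∀ {u} → u List.∈ x ∷ xs ⊎ ∃[ k ] ((u , k) List.∈ es × k ≤ suc ℓ) →
           u List.∈ xs ⊎ ∃[ k ] ((u , k) List.∈ es ∷ʳ (x , suc ℓ) × k ≤ suc ℓ)
    seen (inj₁ (here refl))     = inj₂ (suc ℓ , ∈-∷ʳ⁺ es , ≤-refl)
    seen (inj₁ (there u∈))      = inj₁ u∈
    seen (inj₂ (k , u∈ , k≤))   = inj₂ (k , ∈-++⁺ˡ u∈ , k≤)

  begin-scan : ∀ {done e todo i} (σ : State b) → Inv done (e ∷ todo) (view σ) →
               Step i (toℕ (proj₁ e)) stepCost skip σ (Scan done e (nbrs (proj₁ e)))
  begin-scan {e = e} σ inv ctx = σ , 1 , ⇓skip , ≤ᵇ⇒≤ _ stepCost _ , ctx , record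
    { todo     = _
    ; inv      = inv
    ; scanned  = λ v~u → inj₁ (from (complete _ _) v~u)
    ; adjacent = All.tabulate (to (complete _ _))
    }

  end-scan : ∀ {done e i} (σ : State b) → Scan done e [] (view σ) →
             Step i (toℕ (proj₁ e)) stepCost skip σ (λ w → ∃[ todo ] Inv (done ∷ʳ e) todo w)
  end-scan {done} {e} σ scan ctx = σ , 1 , ⇓skip , ≤ᵇ⇒≤ _ stepCost _ , ctx , todo , record
    { es        = es
    ; frontier  = dequeue G r frontier (found ∘ scanned)
    ; level     = level
    ; unvisited = unvisited
    ; queued    = queued
    ; tail≡     = tail≡
    ; bits      = bits
    }
    where
    open Scan scan
    found : ∀ {u} → u List.∈ [] ⊎ ∃[ k ] ((u , k) List.∈ es × k ≤ suc (proj₂ e)) →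
            ∃[ k ] ((u , k) List.∈ es × k ≤ suc (proj₂ e))
    found (inj₂ u∈) = u∈

  open Sweep {pre = skip} {body = visit} {post = skip} Inv Scan
    (λ {done} inv → length-prefix≤n done (Frontier.distinct (Inv.frontier inv))
                                        (Frontier.split (Inv.frontier inv)))
    (λ inv → trans (Inv.tail≡ inv) (cong length (Frontier.split (Inv.frontier inv))))
    (λ {done} {w = w} inv → queue-lookup done
      (subst (QueueArray (View.queue w)) (Frontier.split (Inv.frontier inv)) (Inv.queued inv)))
    begin-scan visit-spec end-scan
    public using () renaming (sweep-runs to bfs-runs)

-- Collecting words from neighbours

-- Invariant of an accumulator that collects C j x over the elements x of a
-- list, of which xs remain: T is what it will represent in the end.
Gathers : ∀ {b} {X : Set} → (Fin b → Set) → (Fin b → X → Set) → List X → Subset b → Set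
Gathers T C xs acc = ∀ j → T j ⇔ (j ∈ acc ⊎ Any (C j) xs)

module _ {b : ℕ} {X : Set} {T : Fin b → Set} {C : Fin b → X → Set}
         {x : X} {xs : List X} {acc : Subset b} where

  gather : ∀ {w} → (∀ j → C j x ⇔ j ∈ w) →
           Gathers T C (x ∷ xs) acc → Gathers T C xs (acc ∪ w)
  gather {w} C⇔w gathers j = mk⇔ (⇒ ∘ to (gathers j)) (from (gathers j) ∘ ⇐)
    where
    ⇒ : j ∈ acc ⊎ Any (C j) (x ∷ xs) → j ∈ acc ∪ w ⊎ Any (C j) xs
    ⇒ (inj₁ j∈)         = inj₁ (x∈p∪q⁺ (inj₁ j∈))
    ⇒ (inj₂ (here c))   = inj₁ (x∈p∪q⁺ (inj₂ (to (C⇔w j) c)))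
    ⇒ (inj₂ (there cs)) = inj₂ cs
    ⇐ : j ∈ acc ∪ w ⊎ Any (C j) xs → j ∈ acc ⊎ Any (C j) (x ∷ xs)
    ⇐ (inj₂ cs) = inj₂ (there cs)
    ⇐ (inj₁ j∈) with x∈p∪q⁻ acc w j∈
    ... | inj₁ j∈acc = inj₁ j∈acc
    ... | inj₂ j∈w   = inj₂ (here (from (C⇔w j) j∈w))

  pass-over : (∀ j → ¬ C j x) → Gathers T C (x ∷ xs) acc → Gathers T C xs acc
  pass-over ¬C gathers j = mk⇔ (⇒ ∘ to (gathers j)) (from (gathers j) ∘ ⇐)
    where
    ⇒ : j ∈ acc ⊎ Any (C j) (x ∷ xs) → j ∈ acc ⊎ Any (C j) xs
    ⇒ (inj₁ j∈)         = inj₁ j∈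
    ⇒ (inj₂ (here c))   = contradiction c (¬C j)
    ⇒ (inj₂ (there cs)) = inj₂ cs
    ⇐ : j ∈ acc ⊎ Any (C j) xs → j ∈ acc ⊎ Any (C j) (x ∷ xs)
    ⇐ (inj₁ j∈) = inj₁ j∈
    ⇐ (inj₂ cs) = inj₂ (there cs)

gathered : ∀ {b} {X : Set} {T : Fin b → Set} {C : Fin b → X → Set} {acc} →
           Gathers T C [] acc → ∀ j → T j ⇔ j ∈ acc
gathered {T = T} {acc = acc} gathers j = mk⇔ (⇒ ∘ to (gathers j)) (from (gathers j) ∘ inj₁)
  where
  ⇒ : j ∈ acc ⊎ Any _ [] → j ∈ acc
  ⇒ (inj₁ j∈) = j∈

-- The two collecting sweeps and their invariants

begin-near : Cmd
begin-near = 0 ≔ wordAt 2 (reg 5)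

visit-near : Cmd
visit-near =
  if (natAt 5 (reg 7) ⊕ lit 1) ≐ natAt 5 (reg 5) ∶ 0 ≔ wordReg 0 or wordAt 0 (reg 7) ∶ skip

end-near : Cmd
end-near = 0 [ reg 5 ]≔ wordReg 0

begin-level : Cmd
begin-level = 0 ≔ zeros

visit-level : Cmd
visit-level =
  if natAt 5 (reg 7) ≐ natAt 5 (reg 5) ∶ 0 ≔ wordReg 0 or wordAt 0 (reg 7) ∶
  if (natAt 5 (reg 7) ⊕ lit 1) ≐ natAt 5 (reg 5) ∶ 0 ≔ wordReg 0 or wordAt 1 (reg 7) ∶ skip

-- The complement removes collected roots that are also nearer to v; subtracting 1 undoes the shift
-- of the stored levels.
end-level : Cmd
end-level =
  1 [ reg 5 ]≔ wordReg 0 and compl (wordAt 0 (reg 5)) ⨾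
  4 [ reg 5 ]≔ natAt 5 (reg 5) ⊝ lit 1

module Passes {b : ℕ} {G : Graph} (A : AdjacencyLists G) (heads value next : ℕ → ℕ)
  (adjacency : ∀ v → LinkedList value next (heads (toℕ v)) (map toℕ (AdjacencyLists.nbrs A v)))
  (r : Graph.V G) (R : RootSet G r b) (es : List (Graph.V G × ℕ)) (order : LevelOrder G r es) where
  open Graph G using (V; n; m; _~_) renaming (sym to ~-sym)
  open AdjacencyLists A using (nbrs; complete)
  open RootSet R using (nth; S; nth-image)
  open Loops {b} A heads value next adjacency
  open LevelOrder order

  nearBit levelBit : V → Fin b → Set
  nearBit v  = Bit R (Near R v)
  levelBit v = Bit R (Level₀ R v)

  record Searched (w : View b) : Set where
    open View w
    field
      level  : LevelArray levels es
      queued : QueueArray queue es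
      tail≡  : tail ≡ length es

  record NearInv (done todo : List Entry) (w : View b) : Set where
    open View w
    field
      searched : Searched w
      split    : es ≡ done ++ todo
      bits     : ∀ v → Represents G R (words 2 (toℕ v)) (_≡ v)
      near     : ∀ {v ℓ} → (v , ℓ) List.∈ done → Represents G R (words 0 (toℕ v)) (Near R v)
    open Searched searched public

  record NearScan (done : List Entry) (e : Entry) (xs : List V) (w : View b) : Set where
    field
      todo     : List Entry
      inv      : NearInv done (e ∷ todo) w
      gathers  : Gathers (nearBit (proj₁ e)) (λ j u → Parent R (proj₁ e) u × nearBit u j) xs (View.acc w)
      adjacent : All (proj₁ e ~_) xs
    open NearInv inv public

    e∈es : e List.∈ es
    e∈es = subst (e List.∈_) (sym split) (∈-++⁺ʳ done (here refl))

  -- The recurrence for S⁻¹(v) is applied here once, to set the target of the accumulator: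
  -- `root-near` covers the initial mark, `near-parent` and `near-child` the neighbours.
  begin-near-spec : ∀ {done e todo i} (σ : State b) → NearInv done (e ∷ todo) (view σ) →
    Step i (toℕ (proj₁ e)) stepCost begin-near σ (NearScan done e (nbrs (proj₁ e)))
  begin-near-spec {done} {v , ℓ} σ inv ctx@(_ , v≡ , _) = _ , _ , ⇓≔ , ≤ᵇ⇒≤ _ stepCost _ , ctx , record
    { todo     = _
    ; inv      = record
      { searched = record { level = level ; queued = queued ; tail≡ = tail≡ }
      ; split = split ; bits = bits ; near = near }
    ; gathers  = λ j → mk⇔ (λ (i , i≡j , p) → ⇒ i≡j (near-parent R p)) ⇐
    ; adjacent = All.tabulate (to (complete _ _))
    }
    where
    open NearInv inv
    word₀ = arrays σ word 2 (regs σ nat 5)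
    bits-v : Represents G R word₀ (_≡ v)
    bits-v = subst (λ k → Represents G R (arrays σ word 2 k) (_≡ v)) (sym v≡) (bits v)
    C : Fin b → V → Set
    C j u = Parent R v u × nearBit u j
    ⇒ : ∀ {i j} → toℕ i ≡ toℕ j →
        nth i ≡ v ⊎ ∃[ u ] (v ~ u × Parent R v u × Near R u (nth i)) →
        j ∈ word₀ ⊎ Any (C j) (nbrs v)
    ⇒ {i} {j} i≡j (inj₁ i-th≡v) = inj₁ (from (bits-v j) (i , i≡j , i-th≡v))
    ⇒ {i} i≡j (inj₂ (u , v~u , parent , p)) =
      inj₂ (List.lose (from (complete v u) v~u) (parent , i , i≡j , p))
    ⇐ : ∀ {j} → j ∈ word₀ ⊎ Any (C j) (nbrs v) → nearBit v j
    ⇐ {j} (inj₁ j∈) with i , i≡j , refl ← to (bits-v j) j∈ =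
      i , i≡j , root-near R (from (nth-image _) (i , refl))
    ⇐ (inj₂ c) with u , u∈ , parent , i , i≡j , p ← List.find c =
      i , i≡j , near-child R (~-sym (to (complete v u) u∈)) parent p

  parent : ∀ {v u k ℓ} → (v , ℓ) List.∈ es → (u , k) List.∈ es → suc k ≡ ℓ → Parent R v u
  parent v∈ u∈ refl = _ , dist u∈ , dist v∈

  sibling : ∀ {v u k ℓ} → (v , ℓ) List.∈ es → (u , k) List.∈ es → k ≡ ℓ → Sibling R v u
  sibling v∈ u∈ refl = _ , dist u∈ , dist v∈

  parent-level : ∀ {v u k ℓ} → (v , ℓ) List.∈ es → (u , k) List.∈ es → Parent R v u → suc k ≡ ℓ
  parent-level v∈ u∈ (_ , du , dv) = trans (cong suc (IsMinimum-unique (dist u∈) du))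
                                           (IsMinimum-unique dv (dist v∈))

  visit-near-spec : ∀ {done e} → BodySpec visit-near (proj₁ e) (NearScan done e)
  visit-near-spec {done} {v , ℓ} {x = x} {xs} σ x≡ scan ctx@(_ , v≡ , _) = go
    where
    open NearScan scan
    x∈′ = neighbour e∈es (All.head adjacent)
    k = proj₁ x∈′
    x∈ : (x , k) List.∈ es
    x∈ = proj₂ x∈′
    L = arrays σ nat 5
    Lx≡ : L (regs σ nat 7) + 1 ≡ suc (suc k)
    Lx≡ = trans (cong (λ i → L i + 1) x≡) (trans (cong (_+ 1) (level x∈)) (+-comm (suc k) 1))
    Lv≡ : L (regs σ nat 5) ≡ suc ℓ
    Lv≡ = trans (cong L v≡) (level e∈es)

    inv′ : ∀ {a} → NearInv done ((v , ℓ) ∷ todo) (record (view σ) { acc = a })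
    inv′ = record
      { searched = record { level = level ; queued = queued ; tail≡ = tail≡ }
      ; split = split ; bits = bits ; near = near }

    go : _
    go with suc k ≟ ℓ
    ... | yes 1+k≡ℓ =
      _ , _ , ⇓if-true (trans (cong₂ _≡ᵇ_ Lx≡ Lv≡) (≡⇒≡ᵇ-true 1+k≡ℓ)) ⇓≔ , ≤ᵇ⇒≤ _ stepCost _ , ctx , record
        { todo     = todo
        ; inv      = inv′
        ; gathers  = gather (λ j → mk⇔ (from (near-x j) ∘ proj₂) (λ j∈ → parent e∈es x∈ 1+k≡ℓ , to (near-x j) j∈))
                            gathers
        ; adjacent = All.tail adjacent
        }
      where
      -- x is on the level below v, hence already processed in this sweep.
      near-x : Represents G R (arrays σ word 0 (regs σ nat 7)) (Near R x)
      near-x = subst (λ i → Represents G R (arrays σ word 0 i) (Near R x)) (sym x≡)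
        (near (nearer-first split x∈ (≤-reflexive 1+k≡ℓ)))
    ... | no 1+k≢ℓ =
      _ , _ , ⇓if-false (trans (cong₂ _≡ᵇ_ Lx≡ Lv≡) (≢⇒≡ᵇ-false 1+k≢ℓ)) ⇓skip , ≤ᵇ⇒≤ _ stepCost _ , ctx , record
        { todo     = todo
        ; inv      = inv′
        ; gathers  = pass-over (λ j (p , _) → 1+k≢ℓ (parent-level e∈es x∈ p)) gathers
        ; adjacent = All.tail adjacent
        }

  -- Queue entries have distinct vertices, so writing the result for the current one spoils no
  -- earlier result.
  store-done : ∀ {A : Set} (P : V → ℕ → A → Set) (f : ℕ → A) {done e todo i a} →
    es ≡ done ++ e ∷ todo → i ≡ toℕ (proj₁ e) → P (proj₁ e) (proj₂ e) a →
    (∀ {v ℓ} → (v , ℓ) List.∈ done → P v ℓ (f (toℕ v))) →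
    ∀ {v ℓ} → (v , ℓ) List.∈ done ∷ʳ e → P v ℓ ((f [ i ↦ a ]) (toℕ v))
  store-done P f {done} split i≡ p ps {v} {ℓ} v∈ with ∈-∷ʳ⁻ done v∈
  ... | inj₁ v∈done = subst (P v ℓ)
    (sym (update-away f (λ i≡v → not-done split v∈done (toℕ-injective (trans (sym i≡) i≡v)))))
    (ps v∈done)
  ... | inj₂ refl   = subst (P v ℓ) (sym (update-at f i≡)) p

  end-near-spec : ∀ {done e i} (σ : State b) → NearScan done e [] (view σ) →
    Step i (toℕ (proj₁ e)) stepCost end-near σ (λ w → ∃[ todo ] NearInv (done ∷ʳ e) todo w)
  end-near-spec {done} {v , ℓ} σ scan ctx@(_ , v≡ , _) = _ , _ , ⇓[]≔ , ≤ᵇ⇒≤ _ stepCost _ , ctx , todo , record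
    { searched = record { level = level ; queued = queued ; tail≡ = tail≡ }
    ; split    = trans split (sym (∷ʳ-++ done _ todo))
    ; bits     = bits
    ; near     = store-done (λ u _ w → Represents G R w (Near R u)) (arrays σ word 0) split v≡
        (λ j → mk⇔ (from (gathered gathers j)) (to (gathered gathers j))) near
    }
    where open NearScan scan

  open Sweep {pre = begin-near} {body = visit-near} {post = end-near} NearInv NearScan
    (λ {done} inv → length-prefix≤n done distinct (NearInv.split inv))
    (λ inv → trans (NearInv.tail≡ inv) (cong length (NearInv.split inv)))
    (λ {done} {w = w} inv → queue-lookup done
      (subst (QueueArray (View.queue w)) (NearInv.split inv) (NearInv.queued inv)))
    begin-near-spec visit-near-spec end-near-spec
    public using () renaming (sweep-runs to near-runs)

  record LevelInv (done todo : List Entry) (w : View b) : Set where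
    open View w
    field
      searched : Searched w
      split    : es ≡ done ++ todo
      near     : ∀ {v ℓ} → (v , ℓ) List.∈ es → Represents G R (words 0 (toℕ v)) (Near R v)
      level₀   : ∀ {v ℓ} → (v , ℓ) List.∈ done → Represents G R (words 1 (toℕ v)) (Level₀ R v)
      dist≡    : ∀ {v ℓ} → (v , ℓ) List.∈ done → dists (toℕ v) ≡ ℓ
    open Searched searched public

  levelContribution : V → Fin b → V → Set
  levelContribution v j u = Sibling R v u × nearBit u j ⊎ Parent R v u × levelBit u j

  record LevelScan (done : List Entry) (e : Entry) (xs : List V) (w : View b) : Set where
    field
      todo     : List Entry
      inv      : LevelInv done (e ∷ todo) w
      gathers  : Gathers (λ j → Any (levelContribution (proj₁ e) j) (nbrs (proj₁ e)))
                         (levelContribution (proj₁ e)) xs (View.acc w)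
      adjacent : All (proj₁ e ~_) xs
    open LevelInv inv public

    e∈es : e List.∈ es
    e∈es = subst (e List.∈_) (sym split) (∈-++⁺ʳ done (here refl))

  -- The target is the plain union of the contributions, so the invariant holds trivially for the
  -- empty word; `Level₀` enters only after the masking.
  begin-level-spec : ∀ {done e todo i} (σ : State b) → LevelInv done (e ∷ todo) (view σ) →
    Step i (toℕ (proj₁ e)) stepCost begin-level σ (LevelScan done e (nbrs (proj₁ e)))
  begin-level-spec {done} {v , ℓ} σ inv ctx = _ , _ , ⇓≔ , ≤ᵇ⇒≤ _ stepCost _ , ctx , record
    { todo     = _
    ; inv      = record
      { searched = record { level = level ; queued = queued ; tail≡ = tail≡ }
      ; split = split ; near = near ; level₀ = level₀ ; dist≡ = dist≡ }
    ; gathers  = λ j → mk⇔ inj₂ λ { (inj₁ j∈⊥) → contradiction j∈⊥ ∉⊥ ; (inj₂ c) → c }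
    ; adjacent = All.tabulate (to (complete _ _))
    }
    where open LevelInv inv

  sibling-level : ∀ {v u k ℓ} → (v , ℓ) List.∈ es → (u , k) List.∈ es → Sibling R v u → k ≡ ℓ
  sibling-level v∈ u∈ (_ , du , dv) = trans (IsMinimum-unique (dist u∈) du) (IsMinimum-unique dv (dist v∈))

  visit-level-spec : ∀ {done e} → BodySpec visit-level (proj₁ e) (LevelScan done e)
  visit-level-spec {done} {v , ℓ} {x = x} {xs} σ x≡ scan ctx@(_ , v≡ , _) = go
    where
    open LevelScan scan
    x∈′ = neighbour e∈es (All.head adjacent)
    k = proj₁ x∈′
    x∈ : (x , k) List.∈ es
    x∈ = proj₂ x∈′
    L = arrays σ nat 5
    Lx≡ : L (regs σ nat 7) ≡ suc k
    Lx≡ = trans (cong L x≡) (level x∈)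
    1+Lx≡ : L (regs σ nat 7) + 1 ≡ suc (suc k)
    1+Lx≡ = trans (cong (_+ 1) Lx≡) (+-comm (suc k) 1)
    Lv≡ : L (regs σ nat 5) ≡ suc ℓ
    Lv≡ = trans (cong L v≡) (level e∈es)

    inv′ : ∀ {a} → LevelInv done ((v , ℓ) ∷ todo) (record (view σ) { acc = a })
    inv′ = record
      { searched = record { level = level ; queued = queued ; tail≡ = tail≡ }
      ; split = split ; near = near ; level₀ = level₀ ; dist≡ = dist≡ }

    go : _
    go with k ≟ ℓ
    ... | yes k≡ℓ =
      _ , _ , ⇓if-true (trans (cong₂ _≡ᵇ_ Lx≡ Lv≡) (≡⇒≡ᵇ-true k≡ℓ)) ⇓≔ , ≤ᵇ⇒≤ _ stepCost _ , ctx , record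
        { todo     = todo
        ; inv      = inv′
        ; gathers  = gather (λ j → mk⇔ (⇒ j) (λ j∈ → inj₁ (sibling e∈es x∈ k≡ℓ , to (near-x j) j∈))) gathers
        ; adjacent = All.tail adjacent
        }
      where
      -- x may still be pending in this sweep, but `near` holds on the whole queue by now.
      near-x : Represents G R (arrays σ word 0 (regs σ nat 7)) (Near R x)
      near-x = subst (λ i → Represents G R (arrays σ word 0 i) (Near R x)) (sym x≡) (near x∈)
      ⇒ : ∀ j → levelContribution v j x → j ∈ arrays σ word 0 (regs σ nat 7)
      ⇒ j (inj₁ (_ , c)) = from (near-x j) c
      ⇒ j (inj₂ (p , _)) = contradiction (trans (parent-level e∈es x∈ p) (sym k≡ℓ)) 1+n≢n
    ... | no k≢ℓ with suc k ≟ ℓ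
    ... | yes 1+k≡ℓ =
      _ , _ ,
      ⇓if-false (trans (cong₂ _≡ᵇ_ Lx≡ Lv≡) (≢⇒≡ᵇ-false k≢ℓ))
        (⇓if-true (trans (cong₂ _≡ᵇ_ 1+Lx≡ Lv≡) (≡⇒≡ᵇ-true 1+k≡ℓ)) ⇓≔) , ≤ᵇ⇒≤ _ stepCost _ , ctx , record
        { todo     = todo
        ; inv      = inv′
        ; gathers  = gather (λ j → mk⇔ (⇒ j) (λ j∈ → inj₂ (parent e∈es x∈ 1+k≡ℓ , to (level-x j) j∈))) gathers
        ; adjacent = All.tail adjacent
        }
      where
      level-x : Represents G R (arrays σ word 1 (regs σ nat 7)) (Level₀ R x)
      level-x = subst (λ i → Represents G R (arrays σ word 1 i) (Level₀ R x)) (sym x≡)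
        (level₀ (nearer-first split x∈ (≤-reflexive 1+k≡ℓ)))
      ⇒ : ∀ j → levelContribution v j x → j ∈ arrays σ word 1 (regs σ nat 7)
      ⇒ j (inj₁ (s , _)) = contradiction (sibling-level e∈es x∈ s) k≢ℓ
      ⇒ j (inj₂ (_ , c)) = from (level-x j) c
    ... | no 1+k≢ℓ =
      _ , _ ,
      ⇓if-false (trans (cong₂ _≡ᵇ_ Lx≡ Lv≡) (≢⇒≡ᵇ-false k≢ℓ))
        (⇓if-false (trans (cong₂ _≡ᵇ_ 1+Lx≡ Lv≡) (≢⇒≡ᵇ-false 1+k≢ℓ)) ⇓skip) , ≤ᵇ⇒≤ _ stepCost _ , ctx , record
        { todo     = todo
        ; inv      = inv′
        ; gathers  = pass-over (λ j → none j) gathers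
        ; adjacent = All.tail adjacent
        }
      where
      none : ∀ j → ¬ levelContribution v j x
      none j (inj₁ (s , _)) = k≢ℓ (sibling-level e∈es x∈ s)
      none j (inj₂ (p , _)) = 1+k≢ℓ (parent-level e∈es x∈ p)

  -- Every contribution is a root with a walk of length d(r , v) to v, and the mask supplies the
  -- missing negation. Conversely the mask deletes no root of S⁰(v): a bit position determines its
  -- root, so a bit in both words would make that root near.
  level₀-represented : ∀ {v ℓ near acc} → (v , ℓ) List.∈ es → Represents G R near (Near R v) →
    (∀ j → Any (levelContribution v j) (nbrs v) ⇔ j ∈ acc) →
    Represents G R (acc ∩ ∁ near) (Level₀ R v)
  level₀-represented {v} {near = near} {acc} v∈ rep gathered j = mk⇔ ⇒ ⇐
    where
    ⇒ : j ∈ acc ∩ ∁ near → levelBit v j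
    ⇒ j∈ with x∈p∩q⁻ acc (∁ near) j∈
    ... | j∈acc , j∈∁near with List.find (from (gathered j) j∈acc)
    ... | u , u∈ , inj₁ (s , i , i≡j , p) = i , i≡j ,
      level₀-sibling R (~-sym (to (complete v u) u∈)) s
        (λ q → x∈∁p⇒x∉p j∈∁near (from (rep j) (i , i≡j , q))) p
    ... | u , u∈ , inj₂ (s , i , i≡j , p) = i , i≡j ,
      level₀-child R (~-sym (to (complete v u) u∈)) s
        (λ q → x∈∁p⇒x∉p j∈∁near (from (rep j) (i , i≡j , q))) p

    ⇐ : levelBit v j → j ∈ acc ∩ ∁ near
    ⇐ (i , i≡j , p) = x∈p∩q⁺ (to (gathered j) (contribution (level₀-neighbour R dists p)) , x∉p⇒x∈∁p far)
      where
      dists : ∀ {u} → v ~ u → ∃ (IsDist G r u)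
      dists v~u = let _ , u∈ = neighbour v∈ v~u in _ , dist u∈
      far : ¬ (j ∈ near)
      far j∈ = let _ , _ , (_ , ¬p , _) , q = Bit-∩ R {Level₀ R v} {Near R v} (i , i≡j , p) (to (rep j) j∈)
               in ¬p q
      contribution : ∃[ u ] (v ~ u × (Sibling R v u × Near R u (nth i) ⊎ Parent R v u × Level₀ R u (nth i))) →
                     Any (levelContribution v j) (nbrs v)
      contribution (u , v~u , inj₁ (s , q)) = List.lose (from (complete v u) v~u) (inj₁ (s , i , i≡j , q))
      contribution (u , v~u , inj₂ (s , q)) = List.lose (from (complete v u) v~u) (inj₂ (s , i , i≡j , q))

  end-level-spec : ∀ {done e i} (σ : State b) → LevelScan done e [] (view σ) →
    Step i (toℕ (proj₁ e)) stepCost end-level σ (λ w → ∃[ todo ] LevelInv (done ∷ʳ e) todo w)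
  end-level-spec {done} {v , ℓ} σ scan ctx@(_ , v≡ , _) =
    _ , _ , ⇓⨾ ⇓[]≔ ⇓[]≔ , ≤ᵇ⇒≤ _ stepCost _ , ctx , todo , record
    { searched = record { level = level ; queued = queued ; tail≡ = tail≡ }
    ; split    = trans split (sym (∷ʳ-++ done _ todo))
    ; near     = near
    ; level₀   = store-done (λ u _ w → Represents G R w (Level₀ R u)) (arrays σ word 1) split v≡
        (level₀-represented e∈es near-v (gathered gathers)) level₀
    ; dist≡    = store-done (λ _ k d → d ≡ k) (arrays σ nat 4) split v≡
        (cong (_∸ 1) (trans (cong (arrays σ nat 5) v≡) (level e∈es))) dist≡
    }
    where
    open LevelScan scan
    near-v : Represents G R (arrays σ word 0 (regs σ nat 5)) (Near R v)
    near-v = subst (λ i → Represents G R (arrays σ word 0 i) (Near R v)) (sym v≡) (near e∈es)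

  open Sweep {pre = begin-level} {body = visit-level} {post = end-level} LevelInv LevelScan
    (λ {done} inv → length-prefix≤n done distinct (LevelInv.split inv))
    (λ inv → trans (LevelInv.tail≡ inv) (cong length (LevelInv.split inv)))
    (λ {done} {w = w} inv → queue-lookup done
      (subst (QueueArray (View.queue w)) (LevelInv.split inv) (LevelInv.queued inv)))
    begin-level-spec visit-level-spec end-level-spec
    public using () renaming (sweep-runs to level-runs)

-- Marking the roots, and the complete algorithm

≡ᵇ-true⇒≡ : ∀ j k → (j ≡ᵇ k) ≡ true → j ≡ k
≡ᵇ-true⇒≡ zero    zero    _  = refl
≡ᵇ-true⇒≡ (suc j) (suc k) eq = cong suc (≡ᵇ-true⇒≡ j k eq)

∈-singleton-bit : ∀ {b k} {j : Fin b} → j ∈ tabulate (λ j → toℕ j ≡ᵇ k) ⇔ toℕ j ≡ k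
∈-singleton-bit {k = k} {j} = mk⇔
  (λ j∈ → ≡ᵇ-true⇒≡ (toℕ j) k (trans (sym (lookup∘tabulate _ j)) ([]=⇒lookup j∈)))
  (λ j≡k → lookup⇒[]= j _ (trans (lookup∘tabulate _ j) (≡⇒≡ᵇ-true j≡k)))

mark-roots : Cmd
mark-roots = while reg 3 ≺ reg 2 ∶ (2 [ natAt 3 (reg 3) ]≔ bit (reg 3) ⨾ 3 ≔ reg 3 ⊕ lit 1)

module _ {b : ℕ} {G : Graph} {r : Graph.V G} (R : RootSet G r b) where
  open Graph G using (V)
  open RootSet R

  MarkedUpTo : ℕ → (ℕ → Subset b) → Set
  MarkedUpTo i f = ∀ v j → j ∈ f (toℕ v) ⇔ (∃[ ι ] (toℕ ι ≡ toℕ j × nth ι ≡ v × toℕ ι < i))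

  -- The write replaces a whole word. As `nth` is injective, no earlier mark is stored at this
  -- vertex.
  mark-next : ∀ {f i k x} ι → toℕ ι ≡ i → k ≡ i → x ≡ toℕ (nth ι) → MarkedUpTo i f →
    MarkedUpTo (suc i) (f [ x ↦ tabulate (λ j → toℕ j ≡ᵇ k) ])
  mark-next {f} ι refl refl refl marked v j with v ≟F nth ι
  ... | yes refl rewrite update-at f {toℕ (nth ι)} {_} {tabulate (λ j → toℕ j ≡ᵇ toℕ ι)} refl = mk⇔
    (λ j∈ → ι , sym (to ∈-singleton-bit j∈) , refl , ≤-refl)
    (λ (κ , κ≡j , eq , _) → from ∈-singleton-bit (trans (sym κ≡j) (cong toℕ (nth-injective eq))))
  ... | no v≢ rewrite update-away f {a = tabulate (λ j → toℕ j ≡ᵇ toℕ ι)} (v≢ ∘ sym ∘ toℕ-injective) = mk⇔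
    (λ j∈ → let κ , κ≡j , eq , κ<ι = to (marked v j) j∈ in κ , κ≡j , eq , ≤-trans κ<ι (n≤1+n _))
    (λ (κ , κ≡j , eq , κ≤ι) → from (marked v j) (κ , κ≡j , eq ,
      ≤∧≢⇒< (s≤s⁻¹ κ≤ι) (λ κ≡ι → v≢ (trans (sym eq) (cong nth (toℕ-injective κ≡ι))))))

  Marked : State b → State b → Set
  Marked σ σ′ = arrays σ′ nat ≡ arrays σ nat × regs σ′ nat 1 ≡ regs σ nat 1 ×
    (∀ v → Represents G R (arrays σ′ word 2 (toℕ v)) (_≡ v))

  -- A round costs 13 = 4 + 5 + 4: the test, the write, the increment. The last test costs 4.
  mark-roots-from : ∀ k {i} (σ : State b) → i + k ≡ ∣ S ∣ → regs σ nat 3 ≡ i → regs σ nat 2 ≡ ∣ S ∣ →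
    (∀ ι → arrays σ nat 3 (toℕ ι) ≡ toℕ (nth ι)) → MarkedUpTo i (arrays σ word 2) →
    Runs mark-roots σ (13 * k + 4) (Marked σ)
  mark-roots-from zero {i} σ i+0≡ i≡ S≡ roots marked =
    σ , 4 , ⇓while-false test≡ , ≤-refl , refl , refl , λ v j → mk⇔
      (λ j∈ → let ι , ι≡j , eq , _ = to (marked v j) j∈ in ι , ι≡j , eq)
      (λ (ι , ι≡j , eq) → from (marked v j)
        (ι , ι≡j , eq , subst (toℕ ι <_) (trans (sym i+0≡) (+-identityʳ i)) (toℕ<n ι)))
    where
    test≡ : (regs σ nat 3 <ᵇ regs σ nat 2) ≡ false
    test≡ = trans (cong₂ _<ᵇ_ i≡ (trans S≡ (trans (sym i+0≡) (+-identityʳ i)))) (<ᵇ-irrefl i)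
  mark-roots-from (suc k) {i} σ i+k≡ i≡ S≡ roots marked =
    let σ′ , t , roots⇓ , t≤ , arrays≡ , r≡ , result = mark-roots-from k {suc i} _
          (trans (sym (+-suc i k)) i+k≡) (trans (cong (_+ 1) i≡) (+-comm i 1)) S≡ roots
          (mark-next {arrays σ word 2} ι (toℕ-fromℕ< i<∣S∣) i≡
            (trans (cong (arrays σ nat 3) (trans i≡ (sym (toℕ-fromℕ< i<∣S∣)))) (roots ι)) marked)
    in σ′ , _ , ⇓while-true test≡ (⇓⨾ ⇓[]≔ ⇓≔) roots⇓ , time t≤ , arrays≡ , r≡ , result
    where
    i<∣S∣ : i < ∣ S ∣
    i<∣S∣ = subst (i <_) i+k≡ (m<m+n i (s≤s z≤n))
    ι = fromℕ< i<∣S∣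
    test≡ : (regs σ nat 3 <ᵇ regs σ nat 2) ≡ true
    test≡ = trans (cong₂ _<ᵇ_ i≡ S≡) (<⇒<ᵇ-true i<∣S∣)
    time : ∀ {t} → t ≤ 13 * k + 4 → 13 + t ≤ 13 * suc k + 4
    time t≤ = ≤-trans (+-monoʳ-≤ 13 t≤) (≤-reflexive (regroup k))
      where
      regroup : ∀ k → 13 + (13 * k + 4) ≡ 13 * suc k + 4
      regroup = solve-∀

  -- The pairs of r with its roots are distinct arcs; this makes the marking loop linear in m.
  ∣S∣≤2m : ∣ S ∣ ≤ Graph.m G + Graph.m G
  ∣S∣≤2m = subst (_≤ Graph.m G + Graph.m G) (length-tabulate {n = ∣ S ∣} (λ i → r , nth i))
    (length-arcs≤2m {G} (Unique.tabulate⁺ (nth-injective ∘ cong proj₂))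
      (All.tabulate⁺ (λ i → S⊆N (nth i) (from (nth-image (nth i)) (i , refl)))))

-- A linear bound on the weight of the reached vertices

module _ {G : Graph} (A : AdjacencyLists G) (r : Graph.V G) where
  open Graph G using (V; m; _~_) renaming (sym to ~-sym)
  open AdjacencyLists A

  degree≥1 : ∀ {u v} → u ~ v → 1 ≤ degree A v
  degree≥1 {u} {v} u~v with nbrs v | from (complete v u) (~-sym u~v)
  ... | _ ∷ _ | _ = s≤s z≤n

  length≤sum-degree : ∀ {us} → All (λ u → 1 ≤ degree A u) us → length us ≤ sum (map (degree A) us)
  length≤sum-degree []         = z≤n
  length≤sum-degree (1≤ ∷ all) = +-mono-≤ 1≤ (length≤sum-degree all)

  -- Only r may have degree 0, and it occurs at most once: this is the extra 1.
  length≤1+sum-degree : ∀ {us} → Unique us → All (λ u → u ≡ r ⊎ 1 ≤ degree A u) us →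
                        length us ≤ suc (sum (map (degree A) us))
  length≤1+sum-degree [] [] = z≤n
  length≤1+sum-degree (_ ∷ us!) (inj₂ 1≤ ∷ all) =
    ≤-trans (+-mono-≤ 1≤ (length≤1+sum-degree us! all)) (≤-reflexive (+-suc _ _))
  length≤1+sum-degree (r∉ ∷ _) (inj₁ refl ∷ all) =
    s≤s (≤-trans (length≤sum-degree (All.zipWith positive (r∉ , all))) (m≤n+m _ _))
    where
    positive : ∀ {u} → r ≢ u × (u ≡ r ⊎ 1 ≤ degree A u) → 1 ≤ degree A u
    positive (r≢u , inj₁ u≡r) = contradiction (sym u≡r) r≢u
    positive (_   , inj₂ 1≤)  = 1≤

  order-length≤ : ∀ {es} → LevelOrder G r es →
                  length (map proj₁ es) ≤ suc (sum (map (degree A) (map proj₁ es)))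
  order-length≤ {es} order = length≤1+sum-degree (AllPairs.map⁺ (LevelOrder.distinct order))
    (All.map⁺ (All.tabulate (λ v∈ → root-or-positive (proj₁ (dist v∈)))))
    where
    open LevelOrder order using (dist)
    root-or-positive : ∀ {v k} → Walk G r v k → v ≡ r ⊎ 1 ≤ degree A v
    root-or-positive {k = zero}  nil = inj₁ refl
    root-or-positive {k = suc _} p   = let _ , _ , u~v = unsnoc p in inj₂ (degree≥1 u~v)

  sum-1+degree : ∀ us → sum (map (suc ∘ degree A) us) ≡ length us + sum (map (degree A) us)
  sum-1+degree []       = refl
  sum-1+degree (u ∷ us) = cong suc (trans (cong (degree A u +_) (sum-1+degree us))
    (regroup (degree A u) (length us) _))
    where
    regroup : ∀ a b c → a + (b + c) ≡ b + (a + c)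
    regroup = solve-∀

  order-weight≤ : ∀ {es} → LevelOrder G r es → sum (map (suc ∘ degree A) (map proj₁ es)) ≤ 4 * suc m
  order-weight≤ {es} order = begin
    sum (map (suc ∘ degree A) us)          ≡⟨ sum-1+degree us ⟩
    length us + sum (map (degree A) us)    ≤⟨ +-monoˡ-≤ _ (order-length≤ order) ⟩
    suc (sum (map (degree A) us)) + sum (map (degree A) us) ≤⟨ +-mono-≤ (s≤s degrees) degrees ⟩
    -- The slack 3 rounds 1 + 4m up to a multiple of m + 1.
    suc (m + m) + (m + m)                  ≤⟨ m≤n+m _ 3 ⟩
    3 + (suc (m + m) + (m + m))            ≡⟨ regroup m ⟩
    4 * suc m                              ∎
    where
    open ≤-Reasoning
    us = map proj₁ es
    degrees = sum-degree≤2m A (AllPairs.map⁺ (LevelOrder.distinct order))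
    regroup : ∀ m → 3 + (suc (m + m) + (m + m)) ≡ 4 * suc m
    regroup = solve-∀

-- The complete algorithm and its running time

start-queue : Cmd
start-queue = 3 ≔ lit 0 ⨾ 5 [ reg 1 ]≔ lit 1 ⨾ 6 [ lit 0 ]≔ natReg 1 ⨾ 4 ≔ lit 1

bfs : Cmd
bfs = mark-roots ⨾ start-queue ⨾ sweep skip visit skip
    ⨾ (3 ≔ lit 0 ⨾ sweep begin-near visit-near end-near)
    ⨾ (3 ≔ lit 0 ⨾ sweep begin-level visit-level end-level)

-- The summands account for mark-roots, start-queue, the search and the two other
-- sweeps, each of which first resets register 3.
bfsCost : ℕ
bfsCost = 30 + (10 + (604 + ((2 + 604) + (2 + 604))))

-- Wrapped in a record, so that Agda compares c and s instead of unfolding c * s.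
record _≤_·_ (t c s : ℕ) : Set where
  constructor bound
  field unbound : t ≤ c * s

LinearRuns : ∀ {b} → ℕ → Cmd → State b → ℕ → (State b → Set) → Set
LinearRuns s p σ c Q = ∃₂ λ σ′ t → ⟨ p , σ ⟩⇓⟨ σ′ , t ⟩ × t ≤ c · s × Q σ′

LinearRuns-⨾ : ∀ {b s p q c d} {σ : State b} {P Q} → LinearRuns s p σ c P →
               (∀ σ′ → P σ′ → LinearRuns s q σ′ d Q) → LinearRuns s (p ⨾ q) σ (c + d) Q
LinearRuns-⨾ {s = s} {c = c} {d} (σ₁ , t , p⇓ , bound t≤ , p) continue with continue σ₁ p
... | σ₂ , u , q⇓ , bound u≤ , q = σ₂ , t + u , ⇓⨾ p⇓ q⇓ ,
  bound (≤-trans (+-mono-≤ t≤ u≤) (≤-reflexive (sym (*-distribʳ-+ s c d)))) , q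

module _ {b : ℕ} {G : Graph} (A : AdjacencyLists G) {r : Graph.V G} (R : RootSet G r b)
  {σ : State b} (input : BFSInput G A r R σ) where
  open Graph G using (V; m)
  open RootSet R
  open BFSInput input
  private
    heads value next : ℕ → ℕ
    heads = arrays σ nat 0
    value = arrays σ nat 1
    next  = arrays σ nat 2

    Bits : (ℕ → Subset b) → Set
    Bits f = ∀ v → Represents G R (f (toℕ v)) (_≡ v)

    module Sweeps = Loops {b} A heads value next adjacency
    module P₁ = BFS A heads value next adjacency r Bits
    module P (es : List Sweeps.Entry) (order : LevelOrder G r es) =
      Passes A heads value next adjacency r R es order

  Linear : Cmd → State b → ℕ → (State b → Set) → Set
  Linear = LinearRuns (suc m)

  -- 604 = 4 · 150 + 4: the weight is at most 4 (m + 1), each unit costs `visitCost`, and the last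
  -- loop test costs 4.
  sweep≤ : ∀ {es all t} → LevelOrder G r es → es ≡ all ++ [] →
           t ≤ Sweeps.weight all * Sweeps.visitCost + 4 → t ≤ 604 · suc m
  sweep≤ {es} {all} {t} order split t≤ = bound (begin
    t                                  ≤⟨ t≤ ⟩
    Sweeps.weight all * Sweeps.visitCost + 4     ≤⟨ +-monoˡ-≤ 4 (*-monoˡ-≤ Sweeps.visitCost weight≤) ⟩
    4 * suc m * 150 + 4                ≤⟨ m≤m+n _ (4 * m) ⟩
    4 * suc m * 150 + 4 + 4 * m        ≡⟨ regroup m ⟩
    604 * suc m                        ∎)
    where
    open ≤-Reasoning
    weight≤ : Sweeps.weight all ≤ 4 * suc m
    weight≤ = subst (λ es → Sweeps.weight es ≤ 4 * suc m) (trans split (++-identityʳ all))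
      (subst (_≤ 4 * suc m) (cong sum (sym (map-∘ es))) (order-weight≤ A r order))
    regroup : ∀ m → 4 * suc m * 150 + 4 + 4 * m ≡ 604 * suc m
    regroup = solve-∀

  marking≤ : 13 * ∣ S ∣ + 4 ≤ 30 * suc m
  marking≤ = begin
    13 * ∣ S ∣ + 4                  ≤⟨ +-monoˡ-≤ 4 (*-monoʳ-≤ 13 (∣S∣≤2m R)) ⟩
    13 * (m + m) + 4                ≤⟨ m≤m+n _ (26 + 4 * m) ⟩
    13 * (m + m) + 4 + (26 + 4 * m) ≡⟨ regroup m ⟩
    30 * suc m                      ∎
    where
    open ≤-Reasoning
    regroup : ∀ m → 13 * (m + m) + 4 + (26 + 4 * m) ≡ 30 * suc m
    regroup = solve-∀

  nothing-marked : MarkedUpTo R 0 (arrays σ word 2)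
  nothing-marked v j rewrite proj₂ freshWord 2 z≤n (toℕ v) =
    mk⇔ (λ j∈⊥ → contradiction j∈⊥ ∉⊥) λ { (_ , _ , _ , ()) }

  marking : Linear mark-roots σ 30 (Marked R σ)
  marking with mark-roots-from R ∣ S ∣ {0} σ refl (proj₁ freshNat 3 ≤-refl) reg-∣S∣ roots nothing-marked
  ... | σ₁ , t , mark⇓ , t≤ , marked = σ₁ , t , mark⇓ , bound (≤-trans t≤ marking≤) , marked

  Started : State b → Set
  Started σ₁ = regs σ₁ nat 3 ≡ 0 × Sweeps.Stored σ₁ × P₁.Inv [] ((r , 0) ∷ []) (view σ₁)

  starting : ∀ σ₁ → Marked R σ σ₁ → Linear start-queue σ₁ 10 Started
  starting σ₁ (arrays≡ , r≡ , bits) = _ , _ , ⇓⨾ ⇓≔ (⇓⨾ ⇓[]≔ (⇓⨾ ⇓[]≔ ⇓≔)) , bound (m≤m*n 10 (suc m)) ,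
    refl , (cong (λ f → f 0) arrays≡ , cong (λ f → f 1) arrays≡ , cong (λ f → f 2) arrays≡) , record
      { es        = (r , 0) ∷ []
      ; frontier  = frontier₀ G r
      ; level     = λ { (here refl) → update-at (arrays σ₁ nat 5) reg₁≡ }
      ; unvisited = unvisited
      ; queued    = reg₁≡ , tt
      ; tail≡     = refl
      ; bits      = bits
      }
    where
    reg₁≡ : regs σ₁ nat 1 ≡ toℕ r
    reg₁≡ = trans r≡ reg-r
    unvisited : ∀ v → (∃[ ℓ ] ((v , ℓ) List.∈ (r , 0) ∷ [])) ⊎
                      (arrays σ₁ nat 5 [ regs σ₁ nat 1 ↦ 1 ]) (toℕ v) ≡ 0
    unvisited v with v ≟F r
    ... | yes refl = inj₁ (0 , here refl)
    -- Fresh memory reads 0, which already means unreached; no pass over all vertices has to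
    -- establish it.
    ... | no v≢r   = inj₂ (trans
      (update-away (arrays σ₁ nat 5) (λ r≡v → v≢r (toℕ-injective (trans (sym r≡v) reg₁≡))))
      (trans (cong (λ f → f 5 (toℕ v)) arrays≡) (proj₂ freshNat 5 (≤ᵇ⇒≤ 4 5 _) (toℕ v))))

  Found : State b → Set
  Found σ₁ = ∃₂ λ es (order : LevelOrder G r es) →
    Sweeps.Stored σ₁ × P.NearInv es order [] es (view σ₁)

  searching : ∀ σ₁ → Started σ₁ → Linear (sweep skip visit skip) σ₁ 604 Found
  searching σ₁ (i≡ , stored₁ , inv₁) = found (P₁.bfs-runs σ₁ i≡ stored₁ inv₁)
    where
    found : ∃[ all ] Runs (sweep skip visit skip) σ₁ (Sweeps.weight all * Sweeps.visitCost + 4)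
                       (λ σ′ → Sweeps.Stored σ′ × P₁.Inv all [] (view σ′)) →
            Linear (sweep skip visit skip) σ₁ 604 Found
    found (all , σ₂ , t , sweep⇓ , t≤ , stored₂ , inv) =
      σ₂ , t , sweep⇓ , sweep≤ order (Frontier.split frontier) t≤ , es , order , stored₂ , record
        { searched = record { level = level ; queued = queued ; tail≡ = tail≡ }
        ; split    = refl
        ; bits     = bits
        ; near     = λ ()
        }
      where
      open P₁.Inv inv
      order = levelOrder G r frontier

  Near-known : State b → Set
  Near-known σ₁ = ∃₂ λ es (order : LevelOrder G r es) →
    Sweeps.Stored σ₁ × P.LevelInv es order [] es (view σ₁)

  nearing : ∀ σ₁ → Found σ₁ →
    Linear (3 ≔ lit 0 ⨾ sweep begin-near visit-near end-near) σ₁ (2 + 604) Near-known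
  nearing σ₁ (es , order , stored₁ , inv₁) =
    LinearRuns-⨾ {c = 2} {P = Ready} (_ , _ , ⇓≔ , bound (m≤m*n 2 (suc m)) , refl , stored₁ , inv₁) main
    where
    Ready : State b → Set
    Ready σ₂ = regs σ₂ nat 3 ≡ 0 × Sweeps.Stored σ₂ × P.NearInv es order [] es (view σ₂)
    known : ∀ {σ₂} →
            ∃[ all ] Runs (sweep begin-near visit-near end-near) σ₂
                       (Sweeps.weight all * Sweeps.visitCost + 4)
                       (λ σ′ → Sweeps.Stored σ′ × P.NearInv es order all [] (view σ′)) →
            Linear (sweep begin-near visit-near end-near) σ₂ 604 Near-known
    known (all , σ₃ , t , sweep⇓ , t≤ , stored₃ , inv) =
      σ₃ , t , sweep⇓ , sweep≤ order split t≤ , es , order , stored₃ , record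
        { searched = record { level = level ; queued = queued ; tail≡ = tail≡ }
        ; split    = refl
        ; near     = λ v∈ → near (subst (_ List.∈_) (trans split (++-identityʳ all)) v∈)
        ; level₀   = λ ()
        ; dist≡    = λ ()
        }
      where open Passes.NearInv inv
    main : ∀ σ₂ → Ready σ₂ → Linear (sweep begin-near visit-near end-near) σ₂ 604 Near-known
    main σ₂ (i≡ , stored₂ , inv₂) = known (P.near-runs es order σ₂ i≡ stored₂ inv₂)

  Solved : State b → Set
  Solved σ₁ = ∃₂ λ es (order : LevelOrder G r es) → ∃[ all ] P.LevelInv es order all [] (view σ₁)

  levelling : ∀ σ₁ → Near-known σ₁ →
    Linear (3 ≔ lit 0 ⨾ sweep begin-level visit-level end-level) σ₁ (2 + 604) Solved
  levelling σ₁ (es , order , stored₁ , inv₁) =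
    LinearRuns-⨾ {c = 2} {P = Ready} (_ , _ , ⇓≔ , bound (m≤m*n 2 (suc m)) , refl , stored₁ , inv₁) main
    where
    Ready : State b → Set
    Ready σ₂ = regs σ₂ nat 3 ≡ 0 × Sweeps.Stored σ₂ × P.LevelInv es order [] es (view σ₂)
    solved : ∀ {σ₂} →
             ∃[ all ] Runs (sweep begin-level visit-level end-level) σ₂
                        (Sweeps.weight all * Sweeps.visitCost + 4)
                        (λ σ′ → Sweeps.Stored σ′ × P.LevelInv es order all [] (view σ′)) →
             Linear (sweep begin-level visit-level end-level) σ₂ 604 Solved
    solved (all , σ₃ , t , sweep⇓ , t≤ , _ , inv) =
      σ₃ , t , sweep⇓ , sweep≤ order (Passes.LevelInv.split inv) t≤ , es , order , all , inv
    main : ∀ σ₂ → Ready σ₂ → Linear (sweep begin-level visit-level end-level) σ₂ 604 Solved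
    main σ₂ (i≡ , stored₂ , inv₂) = solved (P.level-runs es order σ₂ i≡ stored₂ inv₂)

  Output : State b → Set
  Output σ′ = ∀ v → (∃[ u ] (u ∈ ⁅ r ⁆ ∪ S × Reachable G u v)) → BFSOutput G r R σ′ v

  -- The single search from r serves all roots, because each root of S is adjacent to r.
  reachable-from-r : ∀ {u v} → u ∈ ⁅ r ⁆ ∪ S → Reachable G u v → Reachable G r v
  reachable-from-r {u} u∈ (_ , p) with x∈p∪q⁻ ⁅ r ⁆ S u∈
  ... | inj₁ u∈r with refl ← x∈⁅y⁆⇒x≡y r u∈r = _ , p
  ... | inj₂ u∈S = _ , cons (S⊆N u u∈S) p

  solved⇒output : ∀ σ′ → Solved σ′ → Output σ′
  solved⇒output σ′ (es , order , all , inv) v (u , u∈ , reach)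
    with LevelOrder.reached order (reachable-from-r u∈ reach)
  ... | ℓ , v∈ = record
    { dist = subst (IsDist G r v) (sym (dist≡ v∈all)) (LevelOrder.dist order v∈)
    ; S⁻¹  = Represents-resp-⇔ R {P = Near R v} (mk⇔ (from (S⁻¹⇔Near R)) (to (S⁻¹⇔Near R))) (near v∈)
    ; S⁰   = Represents-resp-⇔ R {P = Level₀ R v} (mk⇔ (from (S⁰⇔Level₀ R)) (to (S⁰⇔Level₀ R))) (level₀ v∈all)
    }
    where
    open Passes.LevelInv inv
    v∈all : (v , ℓ) List.∈ all
    v∈all = subst (_ List.∈_) (trans split (++-identityʳ all)) v∈

  bfs-linear : Linear bfs σ bfsCost Solved
  bfs-linear = LinearRuns-⨾ marking λ σ₁ p₁ → LinearRuns-⨾ (starting σ₁ p₁) λ σ₂ p₂ →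
    LinearRuns-⨾ (searching σ₂ p₂) λ σ₃ p₃ → LinearRuns-⨾ (nearing σ₃ p₃) levelling

  bfs-correct : ∃₂ λ σ′ t → ⟨ bfs , σ ⟩⇓⟨ σ′ , t ⟩ × t ≤ bfsCost * suc m × Output σ′
  bfs-correct = conclude bfs-linear
    where
    conclude : Linear bfs σ bfsCost Solved →
               ∃₂ λ σ′ t → ⟨ bfs , σ ⟩⇓⟨ σ′ , t ⟩ × t ≤ bfsCost * suc m × Output σ′
    conclude (σ′ , t , bfs⇓ , bound t≤ , solved) = σ′ , t , bfs⇓ , t≤ , solved⇒output σ′ solved

open Graph using (V; m)
open RootSet using (S)

mainTheorem4 : (∃₂ λ (bfs : Cmd) (c : ℕ) →
    ∀ (b : ℕ) (G : Graph) (A : AdjacencyLists G) (r : V G) (R : RootSet G r b) →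
    ∀ (σ : State b) → BFSInput G A r R σ →
    ∃₂ λ (σ′ : State b) (time : ℕ) →
    ⟨ bfs , σ ⟩⇓⟨ σ′ , time ⟩
    × time ≤ c * suc (m G)
    × (∀ (v : V G) →
    (∃[ u ] (u ∈ ⁅ r ⁆ ∪ S R × Reachable G u v)) →
    BFSOutput G r R σ′ v))
    × (∃₂ λ (query : Cmd) (c : ℕ) →
    ∀ (b : ℕ) (G : Graph) (r : V G) (R : RootSet G r b) (s t : V G) →
    Reachable G r s → Reachable G r t →
    ∀ (σ : State b) → QueryInput G r R s t σ →
    ∃₂ λ (σ′ : State b) (time : ℕ) →
    ⟨ query , σ ⟩⇓⟨ σ′ , time ⟩
    × time ≤ c
    × IsMinimum
    (λ k → ∃[ u ] (u ∈ ⁅ r ⁆ ∪ S R ×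
    (∃₂ λ x y → IsDist G s u x × IsDist G u t y × k ≡ x + y)))
    (regs σ′ nat 2))
mainTheorem4 =
  (bfs , bfsCost , λ b G A r R σ input → bfs-correct A R input) ,
  (query , 25 , λ b G r R s t _ _ σ input → query-correct R input)
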